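{- Let $(G,\sigma)$ be a finite connected signed graph and $p>1$. Then the first (smallest) nonzero eigenvalue $\lambda_p^\sigma$ of the signed $p$-Laplacian $\Delta_p^\sigma$ satisfies \[ \lambda_{p}^{\sigma}\geq\frac{1}{2}\left(\frac{2}{p\cdot \mathrm{vol}(G)}\right)^{p}, \] where $\mathrm{vol}(G)=\sum_{x\in V}d_x$.
   Context: $G=(V,E)$ is a finite simple connected graph with degrees $d_x$; $\sigma:E\to\{\pm1\}$, $\sigma_{xy}=\sigma(\{x,y\})$. For $p>1$, $\Delta_{p}^{\sigma}f(x)=\frac{1}{d_{x}}\sum_{y\sim x}|\sigma_{xy}f(y)-f(x)|^{p-2}(\sigma_{xy}f(y)-f(x))$ (with $|t|^{p-2}t=0$ at $t=0$). A real $\lambda$ is an eigenvalue of $\Delta_p^\sigma$ if there is a nonzero $f$ with $-\Delta_{p}^{\sigma}f(x)=\lambda|f(x)|^{p-2}f(x)$ for all $x\in V$. -}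

module Defs where

open import Algebra.Bundles using (CommutativeRing; Semiring)
open import Data.Bool.Base using (if_then_else_)
open import Data.Fin.Base using (Fin)
open import Data.Integer.Base as ℤ using (ℤ)
open import Data.Nat.Base using (ℕ; suc; +-0-rawMonoid)
open import Data.Product.Base using (∃; _×_)
open import Data.Rational.Unnormalised.Base using (ℚᵘ; ↥_; ↧ₙ_)
open import Data.Sign.Base using (Sign)
open import Level using (0ℓ)
open import Relation.Binary.Construct.Closure.ReflexiveTransitive using (Star)
import Relation.Binary.Construct.NonStrictToStrict as ToStrict
open import Relation.Binary.Core using (Rel)
open import Relation.Binary.Definitions using (Decidable; Symmetric)
open import Relation.Binary.PropositionalEquality.Core using (_≡_)
open import Relation.Binary.Structures using (IsDecTotalOrder)
open import Relation.Nullary using (¬_; Dec; yes; no; does)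
import Algebra.Definitions.RawMonoid as RawMonoid
import Algebra.Definitions.RawSemiring as RawSemiring

-- The real numbers, axiomatised as a complete (Dedekind) ordered field.
-- Classically there is exactly one model up to isomorphism.
--
-- Whether a predicate is nonempty and bounded above cannot be decided without
-- excluded middle, so sup is a total operation about which nothing is assumed
-- at other predicates; likewise nothing is assumed about 0# ⁻¹.
record CompleteOrderedField : Set₁ where
  field
    commutativeRing : CommutativeRing 0ℓ 0ℓ

  open CommutativeRing commutativeRing public

  infix 4 _≤_ _<_
  infix 9 _⁻¹

  field
    _≤_             : Rel Carrier 0ℓ
    isDecTotalOrder : IsDecTotalOrder _≈_ _≤_
    +-monoʳ-≤       : ∀ x {y z} → y ≤ z → x + y ≤ x + z
    *-nonNegative   : ∀ {x y} → 0# ≤ x → 0# ≤ y → 0# ≤ x * y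
    1≉0             : 1# ≉ 0#
    _⁻¹             : Carrier → Carrier
    ⁻¹-inverseʳ     : ∀ {x} → x ≉ 0# → x * x ⁻¹ ≈ 1#

  IsUpperBound : (Carrier → Set) → Carrier → Set
  IsUpperBound P u = ∀ {x} → P x → x ≤ u

  IsLeast : (Carrier → Set) → Carrier → Set
  IsLeast P m = P m × (∀ {x} → P x → m ≤ x)

  field
    sup            : (Carrier → Set) → Carrier
    sup-isSupremum : ∀ P → ∃ P → ∃ (IsUpperBound P) →
                     IsLeast (IsUpperBound P) (sup P)

  open IsDecTotalOrder isDecTotalOrder public
    using (_≤?_; ≤-respˡ-≈; ≤-respʳ-≈)
    renaming ( _≟_ to _≈?_; total to ≤-total; antisym to ≤-antisym
             ; refl to ≤-refl; trans to ≤-trans; reflexive to ≤-reflexive )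

  _<_ : Rel Carrier 0ℓ
  _<_ = ToStrict._<_ _≈_ _≤_

  open RawSemiring (Semiring.rawSemiring semiring) public
    using (sum; _^_)
    renaming (_×_ to _·_)

  fromℕ : ℕ → Carrier
  fromℕ n = n · 1#

  fromℤ : ℤ → Carrier
  fromℤ (ℤ.+ n)    = fromℕ n
  fromℤ ℤ.-[1+ n ] = - fromℕ (suc n)

  ∣_∣ : Carrier → Carrier
  ∣ x ∣ = if does (0# ≤? x) then x else - x

  infixr 8 _^ℤ_ _^ℝ_

  _^ℤ_ : Carrier → ℤ → Carrier
  x ^ℤ (ℤ.+ n)    = x ^ n
  x ^ℤ ℤ.-[1+ n ] = (x ^ suc n) ⁻¹

  -- For b ≥ 1: y lies in [0 , b ^ r] for some rational r = m / n ≤ a.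
  -- The condition y ≤ b ^ (m / n) is written as y ^ n ≤ b ^ m.
  BelowRationalPower : Carrier → Carrier → Carrier → Set
  BelowRationalPower b a y = ∃ λ (r : ℚᵘ) →
    (fromℤ (↥ r) ≤ fromℕ (↧ₙ r) * a) × (0# ≤ y) × (y ^ (↧ₙ r) ≤ b ^ℤ (↥ r))

  -- Powers with real exponent of a nonnegative base: for x ≥ 1 the supremum
  -- of the x ^ r over rational r ≤ a, and (x ⁻¹) ^ (- a) for 0 < x < 1.
  -- The value 0# at x = 0 is correct for a > 0 and a convention otherwise;
  -- negative bases are never used.
  _^ℝ_ : Carrier → Carrier → Carrier
  x ^ℝ a =
    if does (x ≤? 0#) then 0#
    else if does (1# ≤? x) then sup (BelowRationalPower x a)
    else sup (BelowRationalPower (x ⁻¹) (- a))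

  infixr 7 _◃_

  _◃_ : Sign → Carrier → Carrier
  Sign.+ ◃ x = x
  Sign.- ◃ x = - x

record SimpleGraph : Set₁ where
  infix 4 _~_ _~?_
  field
    order    : ℕ
    _~_      : Rel (Fin order) 0ℓ
    _~?_     : Decidable _~_
    ~-sym    : Symmetric _~_
    ~-irrefl : ∀ {x} → ¬ (x ~ x)

  V : Set
  V = Fin order

  Connected : Set
  Connected = ∀ x y → Star _~_ x y

  degree : V → ℕ
  degree x = RawMonoid.sum +-0-rawMonoid
    λ y → if does (x ~? y) then 1 else 0

  vol : ℕ
  vol = RawMonoid.sum +-0-rawMonoid degree

-- A sign for every undirected edge: `undirected` makes σ independent both of
-- the orientation and of the proof of adjacency.
record Signature (G : SimpleGraph) : Set where
  open SimpleGraph G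
  field
    σ          : ∀ {x y} → x ~ y → Sign
    undirected : ∀ {x y} (e : x ~ y) (e′ : y ~ x) → σ e ≡ σ e′

module SignedPLaplacian
  (ℝ : CompleteOrderedField)
  (G : SimpleGraph)
  (S : Signature G)
  where

  open CompleteOrderedField ℝ
  open SimpleGraph G
  open Signature S

  2# : Carrier
  2# = 1# + 1#

  -- φ p t = |t|^(p-2) t; at t = 0 this is 0, since 0# ^ℝ a = 0# for every a.
  φ : Carrier → Carrier → Carrier
  φ p t = ∣ t ∣ ^ℝ (p - 2#) * t

  sumNeighbours : ∀ x → (∀ {y} → x ~ y → Carrier) → Carrier
  sumNeighbours x g = sum λ y → term (x ~? y)
    where
    term : ∀ {y} → Dec (x ~ y) → Carrier
    term (yes e) = g e
    term (no _)  = 0#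

  -- On the one-vertex graph the neighbour sum is 0, so Δ p f = 0 whatever
  -- the inverse of the degree 0 is.
  Δ : Carrier → (V → Carrier) → V → Carrier
  Δ p f x = fromℕ (degree x) ⁻¹ *
    sumNeighbours x λ {y} e → φ p (σ e ◃ f y - f x)

  IsEigenvalue : Carrier → Carrier → Set
  IsEigenvalue p μ = ∃ λ (f : V → Carrier) →
    ¬ (∀ x → f x ≈ 0#) × (∀ x → - Δ p f x ≈ μ * φ p (f x))

  IsFirstNonzeroEigenvalue : Carrier → Carrier → Set
  IsFirstNonzeroEigenvalue p =
    IsLeast λ μ → IsEigenvalue p μ × μ ≉ 0#

{-# OPTIONS --safe #-}

-- Let f be an eigenfunction for μ ≠ 0, M = max ∣f∣ and δ xy = f x - σ f y on edges.
-- Testing the equation against f gives 2 μ Σ dₓ ∣f x∣^p = Σ ∣δ xy∣^p, the sum being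
-- over ordered pairs of adjacent vertices.  Some edge satisfies f x · σ f y ≤ 0:
-- otherwise testing against the signs of f gives μ Σ dₓ ∣f x∣^(p-1) = 0.  On such
-- an edge ∣δ∣ = ∣f x∣ + ∣f y∣, and ∣f∣ varies by at most ∣δ∣ along every edge, so a
-- path from a maximum of ∣f∣ to that edge shows Σ ∣δ xy∣ ≥ 2 M.  Finally, with
-- κ = 2 / (p vol) and c = M κ, summing ∣δ∣^p ≥ c^p (∣δ∣ / c - (p - 1)) over the
-- vol ordered pairs gives Σ ∣δ xy∣^p ≥ vol c^p, whence μ ≥ κ^p / 2.

module Submission where

open import Defs
open import Algebra.Bundles using (CommutativeRing)
import Algebra.Definitions.RawMonoid as RawMonoid
import Algebra.Properties.CommutativeSemiring.Exp as CommutativeSemiringExp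
import Algebra.Properties.Ring as RingProperties
import Algebra.Properties.Semiring.Exp as SemiringExp
import Algebra.Properties.Semiring.Mult as SemiringMult
import Algebra.Properties.Semiring.Mult.TCOptimised as SemiringMult′
import Algebra.Properties.Semiring.Sum as SemiringSum
import Algebra.Solver.Ring as RingSolver
open import Algebra.Solver.Ring.AlmostCommutativeRing
  using (fromCommutativeRing; _-Raw-AlmostCommutative⟶_)
open import Data.Bool.Base using (Bool; true; false; if_then_else_; _∧_; _∨_)
import Data.Bool.Properties as Bool
open import Data.Empty using (⊥)
open import Data.Fin.Base using (Fin; zero; suc)
import Data.Fin.Properties as Fin
open import Data.Integer.Base as ℤ using (ℤ)
import Data.Integer.Properties as ℤ
open import Data.Maybe.Base using (Maybe; just; nothing)
open import Data.Nat.Base as ℕ using (ℕ; zero; suc; +-0-rawMonoid)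
import Data.Nat.Properties as ℕ
open import Data.Product.Base using (∃; ∃₂; _×_; _,_; proj₁; proj₂)
open import Data.Rational.Unnormalised.Base using (mkℚᵘ)
open import Data.Sign.Base using (Sign)
open import Data.Sum.Base using (_⊎_; inj₁; inj₂)
open import Function.Base using (_∘_; case_of_)
open import Level using (0ℓ)
open import Relation.Binary.Bundles using (Poset)
open import Relation.Binary.Construct.Closure.ReflexiveTransitive using (Star; ε; _◅_)
import Relation.Binary.Construct.NonStrictToStrict as ToStrict
open import Relation.Binary.Core using (Rel)
open import Relation.Binary.PropositionalEquality.Core as ≡ using (_≡_; _≢_)
import Relation.Binary.Reasoning.PartialOrder as PartialOrderReasoning
import Relation.Binary.Reasoning.Setoid as SetoidReasoning
open import Relation.Binary.Structures using (IsDecTotalOrder)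
open import Relation.Nullary using (¬_; Dec; yes; no; does; contradiction)
open import Relation.Nullary.Decidable using (decidable-stable; dec-true; dec-false)

-- The order is decidable, but nothing is known about `sup` at a predicate unless an element and an
-- upper bound are supplied. For the set defining a real power both come from an integer part of the
-- exponent, known only up to double negation. Real powers are therefore handled entirely through
-- inequalities, which are stable, and their laws are equations obtained by antisymmetry.
--
-- In the estimate Σ ∣δ xy∣ ≥ 2 M the 2 arises because every unordered pair is summed twice while
-- the path can be made to use it at most once. The path stops at its first endpoint of the chosen
-- edge, and the value of ∣f∣ remaining there is paid for by that edge itself.
--
-- The tangent inequality is applied with slope 1. The p in κ makes 2 M / c equal to p vol, so
-- subtracting (p - 1) vol leaves exactly vol copies of c^p. A vertex without neighbours cannot
-- occur: there the equation reads 0 = μ φ(f x), and by connectedness it would be the only vertex.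

-- A ring solver with integer coefficients.

module IntegerSolver (R : CommutativeRing 0ℓ 0ℓ) where
  open CommutativeRing R hiding (zero)
  open RingProperties ring
  open SemiringMult′ semiring using () renaming (_×_ to _×′_; 1+× to 1+×′; ×-homo-+ to ×′-homo-+; ×1-homo-* to ×′1-homo-*)
  open SetoidReasoning setoid

  -- The optimised multiple sends 1 to `1#` itself rather than to `1# + 0#`, so the constants `:0`
  -- and `:1` evaluate definitionally to `0#` and `1#` and match goals as written.
  ι : ℤ → Carrier
  ι (ℤ.+ n)    = n ×′ 1#
  ι ℤ.-[1+ n ] = - (suc n ×′ 1#)

  ι-neg : ∀ i → ι (ℤ.- i) ≈ - ι i
  ι-neg ℤ.-[1+ n ]      = sym (-‿involutive _)
  ι-neg (ℤ.+ zero)      = sym -0#≈0#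
  ι-neg (ℤ.+ (suc n))   = refl

  ι-⊖ : ∀ m n → ι (m ℤ.⊖ n) ≈ m ×′ 1# - n ×′ 1#
  ι-⊖ zero    zero    = sym (-‿inverseʳ _)
  ι-⊖ zero    (suc n) = sym (+-identityˡ _)
  ι-⊖ (suc m) zero    = sym (trans (+-congˡ -0#≈0#) (+-identityʳ _))
  ι-⊖ (suc m) (suc n) = begin
    ι (suc m ℤ.⊖ suc n)            ≡⟨ ≡.cong ι (ℤ.[1+m]⊖[1+n]≡m⊖n m n) ⟩
    ι (m ℤ.⊖ n)                    ≈⟨ ι-⊖ m n ⟩
    a - b                          ≈⟨ +-congʳ (xyx⁻¹≈y 1# a) ⟨
    1# + a - 1# - b                ≈⟨ +-assoc _ _ _ ⟩
    1# + a + (- 1# - b)            ≈⟨ +-congˡ (-‿+-comm 1# b) ⟩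
    1# + a - (1# + b)              ≈⟨ +-cong (1+×′ m 1#) (-‿cong (1+×′ n 1#)) ⟨
    suc m ×′ 1# - suc n ×′ 1#        ∎
    where a = m ×′ 1#
          b = n ×′ 1#

  ι-+ : ∀ i j → ι (i ℤ.+ j) ≈ ι i + ι j
  ι-+ (ℤ.+ m)    (ℤ.+ n)    = ×′-homo-+ 1# m n
  ι-+ (ℤ.+ m)    ℤ.-[1+ n ] = ι-⊖ m (suc n)
  ι-+ ℤ.-[1+ m ] (ℤ.+ n)    = trans (ι-⊖ n (suc m)) (+-comm _ _)
  ι-+ ℤ.-[1+ m ] ℤ.-[1+ n ] = begin
    - (suc (suc (m ℕ.+ n)) ×′ 1#)    ≡⟨ ≡.cong (λ k → - (k ×′ 1#)) (ℕ.+-suc (suc m) n) ⟨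
    - ((suc m ℕ.+ suc n) ×′ 1#)      ≈⟨ -‿cong (×′-homo-+ 1# (suc m) (suc n)) ⟩
    - (suc m ×′ 1# + suc n ×′ 1#)     ≈⟨ -‿+-comm _ _ ⟨
    - (suc m ×′ 1#) - suc n ×′ 1#     ∎

  ι-+* : ∀ m j → ι (ℤ.+ m ℤ.* j) ≈ m ×′ 1# * ι j
  ι-+* m (ℤ.+ n)    = trans (reflexive (≡.cong ι (≡.sym (ℤ.pos-* m n)))) (×′1-homo-* m n)
  ι-+* m ℤ.-[1+ n ] = begin
    ι (ℤ.+ m ℤ.* ℤ.-[1+ n ])          ≡⟨ ≡.cong ι (ℤ.neg-distribʳ-* (ℤ.+ m) (ℤ.+ suc n)) ⟨
    ι (ℤ.- (ℤ.+ m ℤ.* ℤ.+ suc n))     ≈⟨ ι-neg (ℤ.+ m ℤ.* ℤ.+ suc n) ⟩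
    - ι (ℤ.+ m ℤ.* ℤ.+ suc n)         ≈⟨ -‿cong (ι-+* m (ℤ.+ suc n)) ⟩
    - (m ×′ 1# * (suc n ×′ 1#))         ≈⟨ -‿distribʳ-* _ _ ⟩
    m ×′ 1# * - (suc n ×′ 1#)           ∎

  ι-* : ∀ i j → ι (i ℤ.* j) ≈ ι i * ι j
  ι-* (ℤ.+ m)    j = ι-+* m j
  ι-* ℤ.-[1+ m ] j = begin
    ι (ℤ.-[1+ m ] ℤ.* j)          ≡⟨ ≡.cong ι (ℤ.neg-distribˡ-* (ℤ.+ suc m) j) ⟨
    ι (ℤ.- (ℤ.+ suc m ℤ.* j))     ≈⟨ ι-neg (ℤ.+ suc m ℤ.* j) ⟩
    - ι (ℤ.+ suc m ℤ.* j)         ≈⟨ -‿cong (ι-+* (suc m) j) ⟩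
    - (suc m ×′ 1# * ι j)          ≈⟨ -‿distribˡ-* _ _ ⟩
    - (suc m ×′ 1#) * ι j          ∎

  ι-morphism : ℤ.+-*-rawRing -Raw-AlmostCommutative⟶ fromCommutativeRing R
  ι-morphism = record
    { ⟦_⟧    = ι
    ; +-homo = ι-+
    ; *-homo = ι-*
    ; -‿homo = ι-neg
    ; 0-homo = refl
    ; 1-homo = refl
    }

  ι-≟ : ∀ i j → Maybe (ι i ≈ ι j)
  ι-≟ i j with i ℤ.≟ j
  ... | yes i≡j = just (reflexive (≡.cong ι i≡j))
  ... | no  _   = nothing

  open RingSolver ℤ.+-*-rawRing (fromCommutativeRing R) ι-morphism ι-≟ public
    using (solve; Polynomial; con; _:+_; _:*_; _:-_; :-_; _:=_)

  :0 :1 : ∀ {n} → Polynomial n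
  :0 = con (ℤ.+ 0)
  :1 = con (ℤ.+ 1)

-- Ordered fields, the Archimedean property and natural powers.

module OrderedField (ℝ : CompleteOrderedField) where
  open CompleteOrderedField ℝ hiding (zero)
  open IntegerSolver commutativeRing public
  open SemiringExp semiring public
    using (^-congˡ; ^-homo-*; ^-assocʳ)
  open CommutativeSemiringExp commutativeSemiring public
    using (^-distrib-*)
  open SemiringMult semiring using (×1-homo-*; ×-homo-+)
  open RingProperties ring public using (-0#≈0#)

  poset : Poset 0ℓ 0ℓ 0ℓ
  poset = record { isPartialOrder = isPartialOrder }
    where open IsDecTotalOrder isDecTotalOrder using (isPartialOrder)

  module ≤-R = PartialOrderReasoning poset
  module ≈-R = SetoidReasoning setoid

  <⇒≤ : ∀ {x y} → x < y → x ≤ y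
  <⇒≤ = ToStrict.<⇒≤ _≈_ _≤_

  <⇒≱ : ∀ {x y} → x < y → ¬ (y ≤ x)
  <⇒≱ = ToStrict.<⇒≱ _≈_ _≤_ ≤-antisym

  ≰⇒> : ∀ {x y} → ¬ (x ≤ y) → y < x
  ≰⇒> = ToStrict.≰⇒> _≈_ _≤_ sym ≤-reflexive ≤-total

  ≰⇒≥ : ∀ {x y} → ¬ (x ≤ y) → y ≤ x
  ≰⇒≥ = <⇒≤ ∘ ≰⇒>

  ≤∨> : ∀ x y → x ≤ y ⊎ y < x
  ≤∨> x y with x ≤? y
  ... | yes p = inj₁ p
  ... | no ¬p = inj₂ (≰⇒> ¬p)

  ≤-by-contradiction : ∀ {x y} → (y < x → ⊥) → x ≤ y
  ≤-by-contradiction {x} {y} f = decidable-stable (x ≤? y) (f ∘ ≰⇒>)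

  +-mono-≤ : ∀ {x y u v} → x ≤ y → u ≤ v → x + u ≤ y + v
  +-mono-≤ {x} {y} {u} {v} p q = begin
    x + u  ≤⟨ +-monoʳ-≤ x q ⟩
    x + v  ≈⟨ +-comm x v ⟩
    v + x  ≤⟨ +-monoʳ-≤ v p ⟩
    v + y  ≈⟨ +-comm v y ⟩
    y + v  ∎
    where open ≤-R

  -- Linear inequalities are reduced to a ring identity y ≈ x + e with e ≥ 0.
  ≤-by : ∀ {x y} e → 0# ≤ e → y ≈ x + e → x ≤ y
  ≤-by {x} {y} e 0≤e eq = begin
    x       ≈⟨ +-identityʳ x ⟨
    x + 0#  ≤⟨ +-monoʳ-≤ x 0≤e ⟩
    x + e   ≈⟨ eq ⟨
    y       ∎
    where open ≤-R

  +-nonNeg : ∀ {x y} → 0# ≤ x → 0# ≤ y → 0# ≤ x + y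
  +-nonNeg p q = ≤-respˡ-≈ (+-identityʳ 0#) (+-mono-≤ p q)

  x≤y⇒0≤y-x : ∀ {x y} → x ≤ y → 0# ≤ y - x
  x≤y⇒0≤y-x {x} {y} p = begin
    0#       ≈⟨ -‿inverseʳ x ⟨
    x - x    ≈⟨ +-comm _ _ ⟩
    - x + x  ≤⟨ +-monoʳ-≤ (- x) p ⟩
    - x + y  ≈⟨ +-comm _ _ ⟩
    y - x    ∎
    where open ≤-R

  0≤y-x⇒x≤y : ∀ {x y} → 0# ≤ y - x → x ≤ y
  0≤y-x⇒x≤y {x} {y} p = ≤-by (y - x) p
    (solve 2 (λ x y → y := x :+ (y :- x)) refl x y)

  neg-≤ : ∀ {x y} → x ≤ y → - y ≤ - x
  neg-≤ {x} {y} p = ≤-by (y - x) (x≤y⇒0≤y-x p)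
    (solve 2 (λ x y → :- x := :- y :+ (y :- x)) refl x y)

  0≤⇒-≤0 : ∀ {x} → 0# ≤ x → - x ≤ 0#
  0≤⇒-≤0 p = ≤-respʳ-≈ -0#≈0# (neg-≤ p)

  ≤0⇒0≤- : ∀ {x} → x ≤ 0# → 0# ≤ - x
  ≤0⇒0≤- p = ≤-respˡ-≈ -0#≈0# (neg-≤ p)

  0<⇒≉0 : ∀ {x} → 0# < x → x ≉ 0#
  0<⇒≉0 (_ , 0≉x) x≈0 = 0≉x (sym x≈0)

  *-monoˡ-≤ : ∀ {x y z} → 0# ≤ z → x ≤ y → z * x ≤ z * y
  *-monoˡ-≤ {x} {y} {z} p q = ≤-by (z * (y - x)) (*-nonNegative p (x≤y⇒0≤y-x q))
    (solve 3 (λ x y z → z :* y := z :* x :+ z :* (y :- x)) refl x y z)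

  *-monoʳ-≤ : ∀ {x y z} → 0# ≤ z → x ≤ y → x * z ≤ y * z
  *-monoʳ-≤ {x} {y} {z} p q = begin
    x * z  ≈⟨ *-comm x z ⟩
    z * x  ≤⟨ *-monoˡ-≤ p q ⟩
    z * y  ≈⟨ *-comm z y ⟩
    y * z  ∎
    where open ≤-R

  *-mono-≤ : ∀ {x y u v} → 0# ≤ x → 0# ≤ v → x ≤ y → u ≤ v → x * u ≤ y * v
  *-mono-≤ p q r s = ≤-trans (*-monoˡ-≤ p s) (*-monoʳ-≤ q r)

  *-⁻¹-cancel : ∀ {x} y → x ≉ 0# → x * (y * x ⁻¹) ≈ y
  *-⁻¹-cancel {x} y x≉0 = begin
    x * (y * x ⁻¹)  ≈⟨ solve 3 (λ x y z → x :* (y :* z) := y :* (x :* z)) refl x y (x ⁻¹) ⟩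
    y * (x * x ⁻¹)  ≈⟨ *-congˡ (⁻¹-inverseʳ x≉0) ⟩
    y * 1#          ≈⟨ *-identityʳ y ⟩
    y               ∎
    where open ≈-R

  *-cancelˡ : ∀ {x y z} → z ≉ 0# → z * x ≈ z * y → x ≈ y
  *-cancelˡ {x} {y} {z} z≉0 zx≈zy = begin
    x               ≈⟨ *-⁻¹-cancel x z≉0 ⟨
    z * (x * z ⁻¹)  ≈⟨ *-assoc _ _ _ ⟨
    z * x * z ⁻¹    ≈⟨ *-congʳ zx≈zy ⟩
    z * y * z ⁻¹    ≈⟨ *-assoc _ _ _ ⟩
    z * (y * z ⁻¹)  ≈⟨ *-⁻¹-cancel y z≉0 ⟩
    y               ∎
    where open ≈-R

  *-≉0 : ∀ {x y} → x ≉ 0# → y ≉ 0# → x * y ≉ 0#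
  *-≉0 x≉0 y≉0 xy≈0 = y≉0 (*-cancelˡ x≉0 (trans xy≈0 (sym (zeroʳ _))))

  *-positive : ∀ {x y} → 0# < x → 0# < y → 0# < x * y
  *-positive p q = *-nonNegative (<⇒≤ p) (<⇒≤ q) ,
    λ 0≈xy → *-≉0 (0<⇒≉0 p) (0<⇒≉0 q) (sym 0≈xy)

  +-positiveˡ : ∀ {x y} → 0# < x → 0# ≤ y → 0# < x + y
  +-positiveˡ {x} {y} (p , 0≉x) q = +-nonNeg p q , λ 0≈x+y → 0≉x (≤-antisym p
    (≤-by y q 0≈x+y))

  *-cancelˡ-≤ : ∀ {x y z} → 0# < z → z * x ≤ z * y → x ≤ y
  *-cancelˡ-≤ {x} {y} {z} 0<z zx≤zy = ≤-by-contradiction λ (y≤x , y≉x) →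
    y≉x (*-cancelˡ (0<⇒≉0 0<z) (≤-antisym (*-monoˡ-≤ (<⇒≤ 0<z) y≤x) zx≤zy))

  square-nonNeg : ∀ x → 0# ≤ x * x
  square-nonNeg x with ≤-total 0# x
  ... | inj₁ p = *-nonNegative p p
  ... | inj₂ p = ≤-respʳ-≈ (solve 1 (λ x → :- x :* :- x := x :* x) refl x)
                   (*-nonNegative (≤0⇒0≤- p) (≤0⇒0≤- p))

  0≤1 : 0# ≤ 1#
  0≤1 = ≤-respʳ-≈ (*-identityˡ 1#) (square-nonNeg 1#)

  0<1 : 0# < 1#
  0<1 = 0≤1 , 1≉0 ∘ sym

  <-≤-trans : ∀ {x y z} → x < y → y ≤ z → x < z
  <-≤-trans = ToStrict.<-≤-trans _≈_ _≤_ sym ≤-trans ≤-antisym ≤-respʳ-≈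

  ≤-<-trans : ∀ {x y z} → x ≤ y → y < z → x < z
  ≤-<-trans = ToStrict.≤-<-trans _≈_ _≤_ ≤-trans ≤-antisym ≤-respˡ-≈

  1≤⇒0< : ∀ {x} → 1# ≤ x → 0# < x
  1≤⇒0< = <-≤-trans 0<1

  1≤* : ∀ {x y} → 1# ≤ x → 1# ≤ y → 1# ≤ x * y
  1≤* 1≤x 1≤y = ≤-respˡ-≈ (*-identityˡ 1#) (*-mono-≤ 0≤1 (<⇒≤ (1≤⇒0< 1≤y)) 1≤x 1≤y)

  ⁻¹-positive : ∀ {x} → 0# < x → 0# < x ⁻¹
  ⁻¹-positive {x} 0<x = ≰⇒> λ x⁻¹≤0 → <⇒≱ 0<1 (begin
    1#        ≈⟨ ⁻¹-inverseʳ (0<⇒≉0 0<x) ⟨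
    x * x ⁻¹  ≤⟨ *-monoˡ-≤ (<⇒≤ 0<x) x⁻¹≤0 ⟩
    x * 0#    ≈⟨ zeroʳ x ⟩
    0#        ∎)
    where open ≤-R

  <⇒0<- : ∀ {x y} → x < y → 0# < y - x
  <⇒0<- {x} {y} (p , x≉y) = x≤y⇒0≤y-x p , λ 0≈y-x → x≉y (begin
    x            ≈⟨ +-identityʳ x ⟨
    x + 0#       ≈⟨ +-congˡ 0≈y-x ⟩
    x + (y - x)  ≈⟨ solve 2 (λ x y → x :+ (y :- x) := y) refl x y ⟩
    y            ∎)
    where open ≈-R

  fromℕ-+ : ∀ m n → fromℕ (m ℕ.+ n) ≈ fromℕ m + fromℕ n
  fromℕ-+ = ×-homo-+ 1#

  fromℕ1 : fromℕ 1 ≈ 1#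
  fromℕ1 = +-identityʳ 1#

  fromℕ-* : ∀ m n → fromℕ (m ℕ.* n) ≈ fromℕ m * fromℕ n
  fromℕ-* = ×1-homo-*

  fromℕ-nonNeg : ∀ n → 0# ≤ fromℕ n
  fromℕ-nonNeg zero    = ≤-refl
  fromℕ-nonNeg (suc n) = +-nonNeg 0≤1 (fromℕ-nonNeg n)

  fromℕ-positive : ∀ n → 0# < fromℕ (suc n)
  fromℕ-positive n = +-positiveˡ 0<1 (fromℕ-nonNeg n)

  fromℕ-mono : ∀ {m n} → m ℕ.≤ n → fromℕ m ≤ fromℕ n
  fromℕ-mono {n = n} ℕ.z≤n = fromℕ-nonNeg n
  fromℕ-mono (ℕ.s≤s p) = +-monoʳ-≤ 1# (fromℕ-mono p)

  fromℕ-cancel : ∀ m n → fromℕ m ≤ fromℕ n → m ℕ.≤ n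
  fromℕ-cancel m n p with m ℕ.≤? n
  ... | yes q = q
  ... | no ¬q = contradiction (≤-trans (fromℕ-mono (ℕ.≰⇒> ¬q)) p)
                  (<⇒≱ (≤-<-trans (≤-reflexive (sym (+-identityˡ _))) lt))
    where
    lt : 0# + fromℕ n < 1# + fromℕ n
    lt = +-mono-≤ 0≤1 ≤-refl , λ eq → 1≉0 (begin
      1#                           ≈⟨ solve 2 (λ x y → x := x :+ y :- y) refl 1# (fromℕ n) ⟩
      1# + fromℕ n - fromℕ n       ≈⟨ +-congʳ eq ⟨
      0# + fromℕ n - fromℕ n       ≈⟨ solve 1 (λ y → :0 :+ y :- y := :0) refl (fromℕ n) ⟩
      0#                           ∎)
      where open ≈-R

  -- If `u` bounded all natural numbers, they would have a supremum, and the supremum minus one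
  -- would still bound them, because the successor of each number is bounded by the supremum.
  archimedean : ∀ {u} → ¬ (∀ n → fromℕ n ≤ u)
  archimedean {u} bound = <⇒≱ lt (proj₂ s-least s-1-upper)
    where
    P : Carrier → Set
    P x = ∃ λ n → x ≤ fromℕ n
    s-least : IsLeast (IsUpperBound P) (sup P)
    s-least = sup-isSupremum P (0# , 0 , ≤-refl) (u , λ (n , x≤n) → ≤-trans x≤n (bound n))
    s-1-upper : IsUpperBound P (sup P - 1#)
    s-1-upper {x} (n , x≤n) = ≤-trans x≤n (0≤y-x⇒x≤y (≤-respʳ-≈
      (solve 3 (λ s x o → s :- (o :+ x) := s :- o :- x) refl (sup P) (fromℕ n) 1#)
      (x≤y⇒0≤y-x (proj₁ s-least (suc n , ≤-refl)))))
    lt : sup P - 1# < sup P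
    lt = ≤-by 1# 0≤1 (solve 2 (λ s o → s := s :- o :+ o) refl (sup P) 1#) ,
      λ eq → 1≉0 (begin
        1#                 ≈⟨ solve 2 (λ s o → o := s :- (s :- o)) refl (sup P) 1# ⟩
        sup P - (sup P - 1#) ≈⟨ +-congˡ (-‿cong eq) ⟩
        sup P - sup P      ≈⟨ -‿inverseʳ _ ⟩
        0#                 ∎)
      where open ≈-R

  multiples-bounded⇒≤0 : ∀ {d u} → (∀ n → fromℕ n * d ≤ u) → d ≤ 0#
  multiples-bounded⇒≤0 {d} {u} bound = ≤-by-contradiction λ 0<d →
    archimedean {u * d ⁻¹} λ n → *-cancelˡ-≤ 0<d (begin
      d * fromℕ n     ≈⟨ *-comm _ _ ⟩
      fromℕ n * d     ≤⟨ bound n ⟩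
      u               ≈⟨ *-⁻¹-cancel u (0<⇒≉0 0<d) ⟨
      d * (u * d ⁻¹)  ∎)
    where open ≤-R

  -- Without Markov's principle the integer part exists only as a
  -- double negation; inequalities are stable, so it may be used to prove them.
  integer-part : ∀ r {x y} →
    (∀ i j → fromℕ i ≤ r + fromℕ j → r + fromℕ j ≤ fromℕ (suc i) → x ≤ y) → x ≤ y
  integer-part r {x} {y} k = ≤-by-contradiction λ y<x →
    -- Shifting by `j` makes the number nonnegative, so its integer part is a natural number found
    -- by bounded search.
    ¬¬above (- r) λ (j , -r≤j) →
    ¬¬above (r + fromℕ j) λ (b , r+j≤b) →
    let 0≤r+j = ≤-respʳ-≈ (solve 2 (λ r j → j :- :- r := r :+ j) refl r (fromℕ j)) (x≤y⇒0≤y-x -r≤j)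
        i , p , q = search (r + fromℕ j) b 0≤r+j (≤-trans r+j≤b (fromℕ-mono (ℕ.n≤1+n b)))
    in <⇒≱ y<x (k i j p q)
    where
    ¬¬above : ∀ u → ¬ ¬ (∃ λ n → u ≤ fromℕ n)
    ¬¬above u ¬∃ = archimedean {u} λ n → ≰⇒≥ λ u≤n → ¬∃ (n , u≤n)

    search : ∀ s b → 0# ≤ s → s ≤ fromℕ (suc b) → ∃ λ i → fromℕ i ≤ s × s ≤ fromℕ (suc i)
    search s zero    0≤s s≤1 = 0 , 0≤s , s≤1
    search s (suc b) 0≤s s≤b with s ≤? fromℕ (suc b)
    ... | yes p = search s b 0≤s p
    ... | no ¬p = suc b , ≰⇒≥ ¬p , s≤b

  1^≈1 : ∀ n → 1# ^ n ≈ 1#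
  1^≈1 zero    = refl
  1^≈1 (suc n) = trans (*-identityˡ _) (1^≈1 n)

  ^-nonNeg : ∀ {x} n → 0# ≤ x → 0# ≤ x ^ n
  ^-nonNeg zero    p = 0≤1
  ^-nonNeg (suc n) p = *-nonNegative p (^-nonNeg n p)

  ^-positive : ∀ {x} n → 0# < x → 0# < x ^ n
  ^-positive zero    p = 0<1
  ^-positive (suc n) p = *-positive p (^-positive n p)

  ^-monoˡ-≤ : ∀ {x y} n → 0# ≤ x → x ≤ y → x ^ n ≤ y ^ n
  ^-monoˡ-≤ zero    p q = ≤-refl
  ^-monoˡ-≤ (suc n) p q = *-mono-≤ p (^-nonNeg n (≤-trans p q)) q (^-monoˡ-≤ n p q)

  1≤^ : ∀ {b} n → 1# ≤ b → 1# ≤ b ^ n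
  1≤^ zero    p = ≤-refl
  1≤^ (suc n) p = ≤-respˡ-≈ (*-identityˡ 1#)
    (*-mono-≤ 0≤1 (^-nonNeg n (≤-trans 0≤1 p)) p (1≤^ n p))

  ^-monoʳ-≤ : ∀ {b m n} → 1# ≤ b → m ℕ.≤ n → b ^ m ≤ b ^ n
  ^-monoʳ-≤ {b} {n = n} 1≤b ℕ.z≤n = 1≤^ n 1≤b
  ^-monoʳ-≤ 1≤b (ℕ.s≤s p) = *-monoˡ-≤ (<⇒≤ (1≤⇒0< 1≤b)) (^-monoʳ-≤ 1≤b p)

  ^-strictMonoˡ : ∀ {x y} n → 0# ≤ x → x < y → x ^ suc n < y ^ suc n
  ^-strictMonoˡ {x} {y} n 0≤x x<y = ≤-<-trans
    (*-monoˡ-≤ 0≤x (^-monoˡ-≤ n 0≤x (<⇒≤ x<y)))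
    (*-monoʳ-≤ (^-nonNeg n (<⇒≤ 0<y)) (<⇒≤ x<y) ,
      λ eq → proj₂ x<y (*-cancelˡ (0<⇒≉0 (^-positive n 0<y))
        (trans (*-comm _ _) (trans eq (*-comm _ _)))))
    where 0<y = ≤-<-trans 0≤x x<y

  ^-cancelˡ-≤ : ∀ {x y} n → 0# ≤ y → x ^ suc n ≤ y ^ suc n → x ≤ y
  ^-cancelˡ-≤ n 0≤y p = ≤-by-contradiction λ y<x → <⇒≱ (^-strictMonoˡ n 0≤y y<x) p

  ^≤1 : ∀ {x} n → 0# ≤ x → x ≤ 1# → x ^ n ≤ 1#
  ^≤1 n 0≤x x≤1 = ≤-respʳ-≈ (1^≈1 n) (^-monoˡ-≤ n 0≤x x≤1)

  bernoulli : ∀ {t} n → 0# ≤ t → 1# + fromℕ n * t ≤ (1# + t) ^ n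
  bernoulli {t} zero    0≤t = ≤-reflexive (trans (+-congˡ (zeroˡ t)) (+-identityʳ 1#))
  bernoulli {t} (suc n) 0≤t = begin
    1# + (1# + k) * t            ≤⟨ ≤-by (k * (t * t)) (*-nonNegative (fromℕ-nonNeg n) (square-nonNeg t))
                                     (solve 2 (λ k t → (:1 :+ t) :* (:1 :+ k :* t)
                                        := :1 :+ (:1 :+ k) :* t :+ k :* (t :* t)) refl k t) ⟩
    (1# + t) * (1# + k * t)      ≤⟨ *-monoˡ-≤ (+-nonNeg 0≤1 0≤t) (bernoulli n 0≤t) ⟩
    (1# + t) * (1# + t) ^ n      ∎
    where open ≤-R
          k = fromℕ n

  -- A constant factor uniform in n is invisible to n-th powers: if x = (1 + t) y with t > 0, then n
  -- t ≤ (1 + t)^n ≤ c for all n, against the Archimedean property. This turns estimates made with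
  -- rounded exponents into exact ones.
  powers-bounded⇒≤ : ∀ {x y} c → 0# ≤ y → (∀ n → x ^ n ≤ c * y ^ n) → x ≤ y
  powers-bounded⇒≤ {x} {y} c 0≤y bound = ≤-by-contradiction λ y<x →
    case y ≈? 0# of λ where
      -- The ratio `t` used in the other case divides by `y`; at y = 0 the bound for n = 1 is
      -- enough.
      (yes y≈0) → <⇒≱ y<x (begin
        x            ≈⟨ *-identityʳ x ⟨
        x * 1#       ≤⟨ bound 1 ⟩
        c * (y * 1#) ≈⟨ *-congˡ (*-congʳ y≈0) ⟩
        c * (0# * 1#) ≈⟨ trans (*-congˡ (zeroˡ _)) (zeroʳ c) ⟩
        0#           ≤⟨ 0≤y ⟩
        y            ∎)
      (no y≉0) →
        let 0<y = (0≤y , y≉0 ∘ sym)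
            t = (x - y) * y ⁻¹
            0<t = *-positive (<⇒0<- y<x) (⁻¹-positive 0<y)
            yt : (1# + t) * y ≈ x
            yt = trans
              (solve 2 (λ t y → (:1 :+ t) :* y := y :+ y :* t) refl t y)
              (trans (+-congˡ (*-⁻¹-cancel (x - y) y≉0))
                (solve 2 (λ x y → y :+ (x :- y) := x) refl x y))
        in <⇒≱ 0<t (multiples-bounded⇒≤0 {u = c} λ n → begin
             fromℕ n * t       ≤⟨ ≤-by 1# 0≤1 (+-comm _ _) ⟩
             1# + fromℕ n * t  ≤⟨ bernoulli n (<⇒≤ 0<t) ⟩
             (1# + t) ^ n      ≤⟨ *-cancelˡ-≤ (^-positive n 0<y) (begin
               y ^ n * (1# + t) ^ n  ≈⟨ *-comm _ _ ⟩
               (1# + t) ^ n * y ^ n  ≈⟨ ^-distrib-* (1# + t) y n ⟨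
               ((1# + t) * y) ^ n    ≈⟨ ^-congˡ n yt ⟩
               x ^ n                 ≤⟨ bound n ⟩
               c * y ^ n             ≈⟨ *-comm _ _ ⟩
               y ^ n * c             ∎) ⟩
             c                 ∎)
    where open ≤-R

-- Real powers of bases at least 1.

module RealPowers (ℝ : CompleteOrderedField) where
  open CompleteOrderedField ℝ hiding (zero)
  open OrderedField ℝ

  <-by : ∀ {x y} e → 0# < e → y ≈ x + e → x < y
  <-by {x} {y} e 0<e eq = ≤-by e (<⇒≤ 0<e) eq , λ x≈y → 0<⇒≉0 0<e (begin
    e              ≈⟨ solve 2 (λ x e → e := x :+ e :- x) refl x e ⟩
    x + e - x      ≈⟨ +-congʳ eq ⟨
    y - x          ≈⟨ +-congˡ (-‿cong x≈y) ⟩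
    y - y          ≈⟨ -‿inverseʳ y ⟩
    0#             ∎)
    where open ≈-R

  product-continuous : ∀ {x y c} → 0# ≤ x → 0# ≤ y → x * y < c →
    ∃₂ λ x′ y′ → x < x′ × y < y′ × x′ * y′ < c
  product-continuous {x} {y} {c} 0≤x 0≤y xy<c =
    x + η , y + η , <-by η 0<η refl , <-by η 0<η refl ,
    <-by (η * (d + (1# - η))) (*-positive 0<η (+-positiveˡ 0<d (x≤y⇒0≤y-x η≤1))) (begin
      c                                  ≈⟨ solve 3 (λ x y c → c := x :* y :+ (c :- x :* y)) refl x y c ⟩
      x * y + d                          ≈⟨ +-congˡ ηD≈d ⟨
      x * y + η * D                      ≈⟨ solve 4 (λ x y d η → x :* y :+ η :* (d :+ (x :+ y :+ :1))
                                              := (x :+ η) :* (y :+ η) :+ η :* (d :+ (:1 :- η))) refl x y d η ⟩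
      (x + η) * (y + η) + η * (d + (1# - η))  ∎)
    where
    open ≈-R
    d = c - x * y
    -- (x + η)(y + η) exceeds x y by η (x + y + η). Since η D = d, the margin left below `c` is η (d
    -- + 1 - η), positive because η ≤ 1.
    D = d + (x + y + 1#)
    η = d * D ⁻¹
    0<d = <⇒0<- xy<c
    0≤x+y+1 = +-nonNeg (+-nonNeg 0≤x 0≤y) 0≤1
    0<D = +-positiveˡ 0<d 0≤x+y+1
    0<η = *-positive 0<d (⁻¹-positive 0<D)
    ηD≈d : η * D ≈ d
    ηD≈d = trans (*-comm η D) (*-⁻¹-cancel d (0<⇒≉0 0<D))
    η≤1 : η ≤ 1#
    η≤1 = *-cancelˡ-≤ 0<D (≤-by (x + y + 1#) 0≤x+y+1
      (trans (*-identityʳ D) (+-congʳ (sym (trans (*-comm D η) ηD≈d)))))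

  power-continuous : ∀ {x c} n → 0# ≤ x → x ^ n < c → ∃ λ z → x < z × z ^ n < c
  power-continuous {x} zero    0≤x x^n<c = x + 1# , <-by 1# 0<1 refl , x^n<c
  power-continuous {x} {c} (suc n) 0≤x x^n<c =
    combine (product-continuous {x} {x ^ n} {c} 0≤x (^-nonNeg n 0≤x) x^n<c)
    where
    combine : (∃₂ λ u w → x < u × x ^ n < w × u * w < c) → ∃ λ z → x < z × z ^ suc n < c
    combine (u , w , x<u , x^n<w , uw<c) = choose (power-continuous {x} {w} n 0≤x x^n<w)
      where
      0≤u = ≤-trans 0≤x (<⇒≤ x<u)
      choose : (∃ λ z → x < z × z ^ n < w) → ∃ λ z → x < z × z ^ suc n < c
      choose (z , x<z , z^n<w) with ≤-total u z
      ... | inj₁ u≤z = u , x<u , ≤-<-trans (*-monoˡ-≤ 0≤u (≤-trans (^-monoˡ-≤ n 0≤u u≤z) (<⇒≤ z^n<w))) uw<c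
      ... | inj₂ z≤u = z , x<z , ≤-<-trans (*-mono-≤ (≤-trans 0≤x (<⇒≤ x<z))
                         (≤-trans (^-nonNeg n 0≤x) (<⇒≤ x^n<w)) z≤u (<⇒≤ z^n<w)) uw<c

  -- Applied with `x` the supremum `P b a`: were the supremum to satisfy the defining inequality
  -- strictly, some number above it would still belong to the set.
  scaled-power-continuous : ∀ {x k c} n → 0# ≤ x → 0# ≤ k → x ^ n * k < c →
    ∃ λ z → x < z × z ^ n * k < c
  scaled-power-continuous n 0≤x 0≤k p =
    let w , k′ , x^n<w , k<k′ , wk′<c = product-continuous (^-nonNeg n 0≤x) 0≤k p
        z , x<z , z^n<w = power-continuous n 0≤x x^n<w
    in z , x<z , ≤-<-trans (*-mono-≤ (^-nonNeg n (≤-trans 0≤x (<⇒≤ x<z)))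
         (≤-trans 0≤k (<⇒≤ k<k′)) (<⇒≤ z^n<w) (<⇒≤ k<k′)) wk′<c

  fromℤ-⊖ : ∀ i j → fromℤ (i ℤ.⊖ j) ≈ fromℕ i - fromℕ j
  fromℤ-⊖ zero    zero    = sym (-‿inverseʳ 0#)
  fromℤ-⊖ zero    (suc j) = sym (+-identityˡ _)
  fromℤ-⊖ (suc i) zero    = sym (trans (+-congˡ -0#≈0#) (+-identityʳ _))
  fromℤ-⊖ (suc i) (suc j) = begin
    fromℤ (suc i ℤ.⊖ suc j)        ≡⟨ ≡.cong fromℤ (ℤ.[1+m]⊖[1+n]≡m⊖n i j) ⟩
    fromℤ (i ℤ.⊖ j)                ≈⟨ fromℤ-⊖ i j ⟩
    fromℕ i - fromℕ j              ≈⟨ solve 3 (λ x y o → x :- y := o :+ x :- (o :+ y)) refl (fromℕ i) (fromℕ j) 1# ⟩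
    fromℕ (suc i) - fromℕ (suc j)  ∎
    where open ≈-R

  ^ℤ-⊖ : ∀ {b} → 0# < b → ∀ i j → b ^ℤ (i ℤ.⊖ j) * b ^ j ≈ b ^ i
  ^ℤ-⊖ 0<b zero    zero    = *-identityʳ 1#
  ^ℤ-⊖ 0<b zero    (suc j) = trans (*-comm _ _) (⁻¹-inverseʳ (0<⇒≉0 (^-positive (suc j) 0<b)))
  ^ℤ-⊖ 0<b (suc i) zero    = *-identityʳ _
  ^ℤ-⊖ {b} 0<b (suc i) (suc j) = begin
    b ^ℤ (suc i ℤ.⊖ suc j) * (b * b ^ j)  ≡⟨ ≡.cong (λ k → b ^ℤ k * (b * b ^ j)) (ℤ.[1+m]⊖[1+n]≡m⊖n i j) ⟩
    b ^ℤ (i ℤ.⊖ j) * (b * b ^ j)          ≈⟨ solve 3 (λ x y z → x :* (y :* z) := y :* (x :* z)) refl (b ^ℤ (i ℤ.⊖ j)) b (b ^ j) ⟩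
    b * (b ^ℤ (i ℤ.⊖ j) * b ^ j)          ≈⟨ *-congˡ (^ℤ-⊖ 0<b i j) ⟩
    b * b ^ i                             ∎
    where open ≈-R

  fromℕ1* : ∀ x → fromℕ 1 * x ≈ x
  fromℕ1* x = trans (*-congʳ fromℕ1) (*-identityˡ x)

  -- BelowRationalPower at the rational (i − j) / (1 + n), free of negative
  -- numerators and of inverses.
  Below : Carrier → Carrier → Carrier → Set
  Below b a y = ∃ λ n → ∃₂ λ i j →
    (fromℕ i ≤ fromℕ (suc n) * a + fromℕ j) × (0# ≤ y) × (y ^ suc n * b ^ j ≤ b ^ i)

  Below⇒BelowRationalPower : ∀ {b a y} → 1# ≤ b → Below b a y → BelowRationalPower b a y
  Below⇒BelowRationalPower {b} {a} {y} 1≤b (n , i , j , i≤ , 0≤y , y^≤) =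
    mkℚᵘ (i ℤ.⊖ j) n ,
    (begin
      fromℤ (i ℤ.⊖ j)        ≈⟨ fromℤ-⊖ i j ⟩
      fromℕ i - fromℕ j      ≤⟨ +-mono-≤ i≤ ≤-refl ⟩
      fromℕ (suc n) * a + fromℕ j - fromℕ j ≈⟨ solve 2 (λ x y → x :+ y :- y := x) refl (fromℕ (suc n) * a) (fromℕ j) ⟩
      fromℕ (suc n) * a      ∎) ,
    0≤y ,
    *-cancelˡ-≤ (^-positive j 0<b) (begin
      b ^ j * y ^ suc n        ≈⟨ *-comm _ _ ⟩
      y ^ suc n * b ^ j        ≤⟨ y^≤ ⟩
      b ^ i                    ≈⟨ ^ℤ-⊖ 0<b i j ⟨
      b ^ℤ (i ℤ.⊖ j) * b ^ j   ≈⟨ *-comm _ _ ⟩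
      b ^ j * b ^ℤ (i ℤ.⊖ j)   ∎)
    where open ≤-R
          0<b = 1≤⇒0< 1≤b

  BelowRationalPower⇒Below : ∀ {b a y} → 1# ≤ b → BelowRationalPower b a y → Below b a y
  BelowRationalPower⇒Below 1≤b (mkℚᵘ (ℤ.+ i) n , i≤ , 0≤y , y^≤) =
    n , i , 0 , ≤-respʳ-≈ (sym (+-identityʳ _)) i≤ , 0≤y , ≤-respˡ-≈ (sym (*-identityʳ _)) y^≤
  BelowRationalPower⇒Below {b} {a} {y} 1≤b (mkℚᵘ ℤ.-[1+ j ] n , i≤ , 0≤y , y^≤) =
    n , 0 , suc j ,
    (begin
      0#                                  ≈⟨ -‿inverseˡ _ ⟨
      - fromℕ (suc j) + fromℕ (suc j)     ≤⟨ +-mono-≤ i≤ ≤-refl ⟩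
      fromℕ (suc n) * a + fromℕ (suc j)   ∎) ,
    0≤y ,
    (begin
      y ^ suc n * b ^ suc j           ≤⟨ *-monoʳ-≤ (<⇒≤ 0<b^) y^≤ ⟩
      (b ^ suc j) ⁻¹ * b ^ suc j      ≈⟨ *-comm _ _ ⟩
      b ^ suc j * (b ^ suc j) ⁻¹      ≈⟨ ⁻¹-inverseʳ (0<⇒≉0 0<b^) ⟩
      1#                              ∎)
    where open ≤-R
          0<b^ = ^-positive (suc j) (1≤⇒0< 1≤b)

  -- The power b ^ a for b ≥ 1.
  P : Carrier → Carrier → Carrier
  P b a = sup (BelowRationalPower b a)

  zero-below : ∀ {b a} i j → 1# ≤ b → fromℕ i ≤ a + fromℕ j → Below b a 0#
  zero-below {b} {a} i j 1≤b i≤ = 0 , i , j , ≤-respʳ-≈ (+-congʳ (sym (fromℕ1* a))) i≤ , ≤-refl ,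
    ≤-respˡ-≈ (sym (trans (*-congʳ (zeroˡ _)) (zeroˡ _))) (^-nonNeg i (<⇒≤ (1≤⇒0< 1≤b)))

  -- The element and the bound that `sup-isSupremum` demands both depend on an integer part of `a`,
  -- which is available only while an inequality is being proved. Hence the supremum property is
  -- passed to a continuation with such a goal.
  P-isSupremum : ∀ {b} a → 1# ≤ b → ∀ {x y} →
    (IsLeast (IsUpperBound (BelowRationalPower b a)) (P b a) → x ≤ y) → x ≤ y
  P-isSupremum {b} a 1≤b k = integer-part a λ i j i≤ ≤i →
    k (sup-isSupremum _
      (0# , Below⇒BelowRationalPower 1≤b (zero-below i j 1≤b i≤))
      (b ^ suc i , λ y∈ → bounded i j ≤i (BelowRationalPower⇒Below 1≤b y∈)))
    where
    open ≤-R
    0<b = 1≤⇒0< 1≤b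
    bounded : ∀ i j → a + fromℕ j ≤ fromℕ (suc i) → ∀ {y} → Below b a y → y ≤ b ^ suc i
    bounded i j a≤ {y} (n , i′ , j′ , i′≤ , 0≤y , y^≤) =
      ^-cancelˡ-≤ n (^-nonNeg (suc i) (<⇒≤ 0<b)) (*-cancelˡ-≤ (^-positive j′ 0<b) (begin
        b ^ j′ * y ^ suc n                ≈⟨ *-comm _ _ ⟩
        y ^ suc n * b ^ j′                ≤⟨ y^≤ ⟩
        b ^ i′                            ≤⟨ ^-monoʳ-≤ 1≤b (fromℕ-cancel i′ (j′ ℕ.+ suc i ℕ.* suc n) i′≤′) ⟩
        b ^ (j′ ℕ.+ suc i ℕ.* suc n)      ≈⟨ ^-homo-* b j′ _ ⟩
        b ^ j′ * b ^ (suc i ℕ.* suc n)    ≈⟨ *-congˡ (^-assocʳ b (suc i) (suc n)) ⟨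
        b ^ j′ * (b ^ suc i) ^ suc n      ∎))
      where
      a≤1+i : a ≤ fromℕ (suc i)
      a≤1+i = ≤-trans (≤-by (fromℕ j) (fromℕ-nonNeg j) refl) a≤
      i′≤′ : fromℕ i′ ≤ fromℕ (j′ ℕ.+ suc i ℕ.* suc n)
      i′≤′ = begin
        fromℕ i′                                     ≤⟨ i′≤ ⟩
        fromℕ (suc n) * a + fromℕ j′                 ≤⟨ +-mono-≤ (*-monoˡ-≤ (fromℕ-nonNeg (suc n)) a≤1+i) ≤-refl ⟩
        fromℕ (suc n) * fromℕ (suc i) + fromℕ j′     ≈⟨ trans (+-comm _ _) (+-congˡ (*-comm _ _)) ⟩
        fromℕ j′ + fromℕ (suc i) * fromℕ (suc n)     ≈⟨ +-congˡ (fromℕ-* (suc i) (suc n)) ⟨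
        fromℕ j′ + fromℕ (suc i ℕ.* suc n)           ≈⟨ fromℕ-+ j′ _ ⟨
        fromℕ (j′ ℕ.+ suc i ℕ.* suc n)               ∎

  P-upper : ∀ {b a y} → 1# ≤ b → Below b a y → y ≤ P b a
  P-upper {a = a} 1≤b y∈ = P-isSupremum a 1≤b λ (ub , _) → ub (Below⇒BelowRationalPower 1≤b y∈)

  P-least : ∀ {b a z} → 1# ≤ b → (∀ {y} → Below b a y → y ≤ z) → P b a ≤ z
  P-least {a = a} 1≤b z-ub = P-isSupremum a 1≤b λ (_ , least) →
    least (z-ub ∘ BelowRationalPower⇒Below 1≤b)

  0≤P : ∀ {b} a → 1# ≤ b → 0# ≤ P b a
  0≤P a 1≤b = integer-part a λ i j i≤ _ → P-upper 1≤b (zero-below i j 1≤b i≤)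

  -- b ^ ((i − j) / n) ≤ P b a for (i − j) / n ≤ a
  P-lower-law : ∀ {b a} n i j → 1# ≤ b → fromℕ i ≤ fromℕ n * a + fromℕ j →
    b ^ i ≤ P b a ^ n * b ^ j
  P-lower-law {b} {a} zero i j 1≤b i≤ = ≤-respʳ-≈ (sym (*-identityˡ _))
    (^-monoʳ-≤ 1≤b (fromℕ-cancel i j (≤-respʳ-≈ (trans (+-congʳ (zeroˡ a)) (+-identityˡ _)) i≤)))
  P-lower-law {b} {a} (suc n) i j 1≤b i≤ = ≤-by-contradiction λ P^<b^ →
    let z , P<z , z^<b^ = scaled-power-continuous (suc n) (0≤P a 1≤b) (^-nonNeg j 0≤b) P^<b^
    in <⇒≱ P<z (P-upper 1≤b (n , i , j , i≤ , ≤-trans (0≤P a 1≤b) (<⇒≤ P<z) , <⇒≤ z^<b^))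
    where 0≤b = <⇒≤ (1≤⇒0< 1≤b)

  0<P : ∀ {b} a → 1# ≤ b → 0# < P b a
  0<P {b} a 1≤b = ≰⇒> λ P≤0 → <⇒≱ 0<1 (integer-part a λ i j i≤ _ → begin
    1#                    ≤⟨ 1≤^ i 1≤b ⟩
    b ^ i                 ≤⟨ P-lower-law 1 i j 1≤b
                               (≤-respʳ-≈ (+-congʳ (sym (fromℕ1* a))) i≤) ⟩
    P b a * 1# * b ^ j    ≤⟨ *-monoʳ-≤ (^-nonNeg j (<⇒≤ (1≤⇒0< 1≤b))) (*-monoʳ-≤ 0≤1 P≤0) ⟩
    0# * 1# * b ^ j       ≈⟨ trans (*-congʳ (zeroˡ _)) (zeroˡ _) ⟩
    0#                    ∎)
    where open ≤-R

  *P-least : ∀ {b a x c} → 1# ≤ b → 0# ≤ x → 0# ≤ c →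
    (∀ {y} → Below b a y → x * y ≤ c) → x * P b a ≤ c
  *P-least {b} {a} {x} {c} 1≤b 0≤x 0≤c ub = case x ≈? 0# of λ where
    (yes x≈0) → ≤-respˡ-≈ (sym (trans (*-congʳ x≈0) (zeroˡ _))) 0≤c
    (no x≉0) →
      let x[cx⁻¹]≈c = *-⁻¹-cancel c x≉0
      in ≤-respʳ-≈ x[cx⁻¹]≈c (*-monoˡ-≤ 0≤x (P-least 1≤b λ y∈ →
           *-cancelˡ-≤ (0≤x , x≉0 ∘ sym) (≤-respʳ-≈ (sym x[cx⁻¹]≈c) (ub y∈))))

  -- A rational exponent at most a and one at most -a have sum at most 0. Raising to the product of
  -- their denominators turns this into a comparison of natural powers of `b`.
  Below-opposite : ∀ {b a y z} → 1# ≤ b → Below b a y → Below b (- a) z → y * z ≤ 1#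
  Below-opposite {b} {a} {y} {z} 1≤b (n , i , j , i≤ , 0≤y , y^≤) (m , k , l , k≤ , 0≤z , z^≤) =
    -- The successor of this number is `N ℕ.* M`, the common denominator. The second cancellation
    -- removes the negative parts of the two numerators, collected on the left as one power of `b`.
    ^-cancelˡ-≤ (m ℕ.+ n ℕ.* suc m) 0≤1 (*-cancelˡ-≤ (^-positive (j ℕ.* M ℕ.+ l ℕ.* N) 0<b) (begin
      b ^ (j ℕ.* M ℕ.+ l ℕ.* N) * (y * z) ^ (N ℕ.* M)
        ≈⟨ *-cong (^-homo-* b (j ℕ.* M) _) (^-distrib-* y z (N ℕ.* M)) ⟩
      b ^ (j ℕ.* M) * b ^ (l ℕ.* N) * (y ^ (N ℕ.* M) * z ^ (N ℕ.* M))
        ≈⟨ solve 4 (λ p q r s → p :* q :* (r :* s) := (r :* p) :* (s :* q)) refl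
             (b ^ (j ℕ.* M)) (b ^ (l ℕ.* N)) (y ^ (N ℕ.* M)) (z ^ (N ℕ.* M)) ⟩
      (y ^ (N ℕ.* M) * b ^ (j ℕ.* M)) * (z ^ (N ℕ.* M) * b ^ (l ℕ.* N))
        ≡⟨ ≡.cong (λ e → (y ^ (N ℕ.* M) * b ^ (j ℕ.* M)) * (z ^ e * b ^ (l ℕ.* N))) (ℕ.*-comm N M) ⟩
      (y ^ (N ℕ.* M) * b ^ (j ℕ.* M)) * (z ^ (M ℕ.* N) * b ^ (l ℕ.* N))
        ≤⟨ *-mono-≤ (*-nonNegative (^-nonNeg (N ℕ.* M) 0≤y) (^-nonNeg (j ℕ.* M) 0≤b))
             (^-nonNeg (k ℕ.* N) 0≤b) (raise y N j i M 0≤y y^≤) (raise z M l k N 0≤z z^≤) ⟩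
      b ^ (i ℕ.* M) * b ^ (k ℕ.* N)                  ≈⟨ ^-homo-* b (i ℕ.* M) _ ⟨
      b ^ (i ℕ.* M ℕ.+ k ℕ.* N)                      ≤⟨ ^-monoʳ-≤ 1≤b (fromℕ-cancel (i ℕ.* M ℕ.+ k ℕ.* N) (j ℕ.* M ℕ.+ l ℕ.* N) exponents) ⟩
      b ^ (j ℕ.* M ℕ.+ l ℕ.* N)                      ≈⟨ *-identityʳ _ ⟨
      b ^ (j ℕ.* M ℕ.+ l ℕ.* N) * 1#                 ≈⟨ *-congˡ (1^≈1 (N ℕ.* M)) ⟨
      b ^ (j ℕ.* M ℕ.+ l ℕ.* N) * 1# ^ (N ℕ.* M)     ∎))
    where
    open ≤-R
    N = suc n
    M = suc m
    0<b = 1≤⇒0< 1≤b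
    0≤b = <⇒≤ 0<b
    raise : ∀ y N j i M → 0# ≤ y → y ^ N * b ^ j ≤ b ^ i →
      y ^ (N ℕ.* M) * b ^ (j ℕ.* M) ≤ b ^ (i ℕ.* M)
    raise y N j i M 0≤y p = begin
      y ^ (N ℕ.* M) * b ^ (j ℕ.* M)   ≈⟨ *-cong (^-assocʳ y N M) (^-assocʳ b j M) ⟨
      (y ^ N) ^ M * (b ^ j) ^ M       ≈⟨ ^-distrib-* _ _ M ⟨
      (y ^ N * b ^ j) ^ M             ≤⟨ ^-monoˡ-≤ M (*-nonNegative (^-nonNeg N 0≤y) (^-nonNeg j 0≤b)) p ⟩
      (b ^ i) ^ M                     ≈⟨ ^-assocʳ b i M ⟩
      b ^ (i ℕ.* M)                   ∎
    exponents : fromℕ (i ℕ.* M ℕ.+ k ℕ.* N) ≤ fromℕ (j ℕ.* M ℕ.+ l ℕ.* N)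
    exponents = begin
      fromℕ (i ℕ.* M ℕ.+ k ℕ.* N)
        ≈⟨ trans (fromℕ-+ (i ℕ.* M) _) (+-cong (fromℕ-* i M) (fromℕ-* k N)) ⟩
      fromℕ i * fromℕ M + fromℕ k * fromℕ N
        ≤⟨ +-mono-≤ (*-monoʳ-≤ (fromℕ-nonNeg M) i≤) (*-monoʳ-≤ (fromℕ-nonNeg N) k≤) ⟩
      (fromℕ N * a + fromℕ j) * fromℕ M + (fromℕ M * - a + fromℕ l) * fromℕ N
        ≈⟨ solve 5 (λ N M a j l → (N :* a :+ j) :* M :+ (M :* (:- a) :+ l) :* N := j :* M :+ l :* N)
             refl (fromℕ N) (fromℕ M) a (fromℕ j) (fromℕ l) ⟩
      fromℕ j * fromℕ M + fromℕ l * fromℕ N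
        ≈⟨ trans (fromℕ-+ (j ℕ.* M) _) (+-cong (fromℕ-* j M) (fromℕ-* l N)) ⟨
      fromℕ (j ℕ.* M ℕ.+ l ℕ.* N)  ∎

  P-opposite-≤ : ∀ {b} a → 1# ≤ b → P b a * P b (- a) ≤ 1#
  P-opposite-≤ {b} a 1≤b = *P-least 1≤b (0≤P a 1≤b) 0≤1 λ {z} z∈ →
    ≤-respˡ-≈ (*-comm _ _) (*P-least 1≤b (0≤z z∈) 0≤1 λ y∈ →
      ≤-respˡ-≈ (*-comm _ _) (Below-opposite 1≤b y∈ z∈))
    where
    0≤z : ∀ {z} → Below b (- a) z → 0# ≤ z
    0≤z (_ , _ , _ , _ , p , _) = p

  -- Upper bounds on a power of the supremum come by duality: `P-lower-law` at `- a` bounds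
  -- `P b (- a)` from below, and the product of the two suprema is at most 1.
  P-upper-law : ∀ {b a} n i j → 1# ≤ b → fromℕ n * a + fromℕ j ≤ fromℕ i →
    P b a ^ n * b ^ j ≤ b ^ i
  P-upper-law {b} {a} n i j 1≤b ≤i = begin
    P b a ^ n * b ^ j                        ≤⟨ *-monoˡ-≤ (^-nonNeg n (0≤P a 1≤b)) (P-lower-law n j i 1≤b j≤) ⟩
    P b a ^ n * (P b (- a) ^ n * b ^ i)      ≈⟨ *-assoc _ _ _ ⟨
    P b a ^ n * P b (- a) ^ n * b ^ i        ≈⟨ *-congʳ (^-distrib-* _ _ n) ⟨
    (P b a * P b (- a)) ^ n * b ^ i          ≤⟨ *-monoʳ-≤ (^-nonNeg i (<⇒≤ (1≤⇒0< 1≤b))) (^≤1 n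
                                                  (*-nonNegative (0≤P a 1≤b) (0≤P (- a) 1≤b)) (P-opposite-≤ a 1≤b)) ⟩
    1# * b ^ i                               ≈⟨ *-identityˡ _ ⟩
    b ^ i                                    ∎
    where
    open ≤-R
    j≤ : fromℕ j ≤ fromℕ n * - a + fromℕ i
    j≤ = begin
      fromℕ j                                     ≈⟨ solve 3 (λ n a j → j := n :* (:- a) :+ (n :* a :+ j)) refl (fromℕ n) a (fromℕ j) ⟩
      fromℕ n * - a + (fromℕ n * a + fromℕ j)     ≤⟨ +-monoʳ-≤ _ ≤i ⟩
      fromℕ n * - a + fromℕ i                     ∎

  -- `sup` is not assumed to respect equivalence of predicates, so congruence has to be derived from
  -- the supremum property.
  P-cong-≤ : ∀ {b c a e} → 1# ≤ b → b ≈ c → a ≈ e → P b a ≤ P c e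
  P-cong-≤ 1≤b b≈c a≈e = P-least 1≤b λ (n , i , j , i≤ , 0≤y , y^≤) →
    P-upper (≤-respʳ-≈ b≈c 1≤b) (n , i , j , ≤-respʳ-≈ (+-congʳ (*-congˡ a≈e)) i≤ , 0≤y ,
      ≤-respʳ-≈ (^-congˡ i b≈c) (≤-respˡ-≈ (*-congˡ (^-congˡ j b≈c)) y^≤))

  P-cong : ∀ {b c a e} → 1# ≤ b → b ≈ c → a ≈ e → P b a ≈ P c e
  P-cong 1≤b b≈c a≈e = ≤-antisym (P-cong-≤ 1≤b b≈c a≈e)
    (P-cong-≤ (≤-respʳ-≈ b≈c 1≤b) (sym b≈c) (sym a≈e))

  *1*1 : ∀ x → x * 1# * 1# ≈ x
  *1*1 x = trans (*-identityʳ _) (*-identityʳ x)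

  P-fromℕ : ∀ {b} k → 1# ≤ b → P b (fromℕ k) ≈ b ^ k
  P-fromℕ {b} k 1≤b = ≤-antisym
    (≤-respˡ-≈ (*1*1 _) (P-upper-law 1 k 0 1≤b (≤-reflexive k≈)))
    (≤-respʳ-≈ (*1*1 _) (P-lower-law 1 k 0 1≤b (≤-reflexive (sym k≈))))
    where
    k≈ : fromℕ 1 * fromℕ k + 0# ≈ fromℕ k
    k≈ = trans (+-identityʳ _) (fromℕ1* (fromℕ k))

  P-zero : ∀ {b} → 1# ≤ b → P b 0# ≈ 1#
  P-zero = P-fromℕ 0

  P-one : ∀ {b} → 1# ≤ b → P b 1# ≈ b
  P-one 1≤b = trans (P-cong 1≤b refl (sym fromℕ1)) (trans (P-fromℕ 1 1≤b) (*-identityʳ _))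

  1≤P : ∀ {b a} → 1# ≤ b → 0# ≤ a → 1# ≤ P b a
  1≤P 1≤b 0≤a = ≤-respʳ-≈ (*1*1 _)
    (P-lower-law 1 0 0 1≤b (+-nonNeg (*-nonNegative (fromℕ-nonNeg 1) 0≤a) ≤-refl))

  -- Both multiplicative laws compare n-th powers through integer parts of
  -- n a, so that each side is only known up to a factor independent of n.
  P-* : ∀ {b c} a → 1# ≤ b → 1# ≤ c → P (b * c) a ≈ P b a * P c a
  P-* {b} {c} a 1≤b 1≤c = ≤-antisym
    (powers-bounded⇒≤ (b * c) (<⇒≤ (*-positive (0<P a 1≤b) (0<P a 1≤c))) λ n →
      integer-part (fromℕ n * a) λ i j i≤ ≤i → *-cancelˡ-≤ (^-positive j 0<bc) (begin
        (b * c) ^ j * Z ^ n      ≈⟨ *-comm _ _ ⟩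
        Z ^ n * (b * c) ^ j      ≤⟨ P-upper-law n (suc i) j 1≤bc ≤i ⟩
        (b * c) * (b * c) ^ i    ≈⟨ *-congˡ (^-distrib-* b c i) ⟩
        (b * c) * (b ^ i * c ^ i) ≤⟨ *-monoˡ-≤ (<⇒≤ 0<bc) (*-mono-≤ (^-nonNeg i 0≤b)
                                      (*-nonNegative (^-nonNeg n (0≤P a 1≤c)) (^-nonNeg j 0≤c))
                                      (P-lower-law n i j 1≤b i≤) (P-lower-law n i j 1≤c i≤)) ⟩
        (b * c) * ((X ^ n * b ^ j) * (Y ^ n * c ^ j))
          ≈⟨ solve 5 (λ k x p y q → k :* ((x :* p) :* (y :* q)) := (p :* q) :* (k :* (x :* y)))
               refl (b * c) (X ^ n) (b ^ j) (Y ^ n) (c ^ j) ⟩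
        (b ^ j * c ^ j) * (b * c * (X ^ n * Y ^ n))
          ≈⟨ *-cong (^-distrib-* b c j) (*-congˡ (^-distrib-* X Y n)) ⟨
        (b * c) ^ j * (b * c * (X * Y) ^ n) ∎))
    (powers-bounded⇒≤ (b * c) (0≤P a 1≤bc) λ n →
      integer-part (fromℕ n * a) λ i j i≤ ≤i → *-cancelˡ-≤ (^-positive j 0<bc) (begin
        (b * c) ^ j * (X * Y) ^ n ≈⟨ *-cong (^-distrib-* b c j) (^-distrib-* X Y n) ⟩
        b ^ j * c ^ j * (X ^ n * Y ^ n)
          ≈⟨ solve 4 (λ x p y q → (p :* q) :* (x :* y) := (x :* p) :* (y :* q))
               refl (X ^ n) (b ^ j) (Y ^ n) (c ^ j) ⟩
        (X ^ n * b ^ j) * (Y ^ n * c ^ j)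
          ≤⟨ *-mono-≤ (*-nonNegative (^-nonNeg n (0≤P a 1≤b)) (^-nonNeg j 0≤b))
               (^-nonNeg (suc i) 0≤c)
               (P-upper-law n (suc i) j 1≤b ≤i) (P-upper-law n (suc i) j 1≤c ≤i) ⟩
        b ^ suc i * c ^ suc i      ≈⟨ ^-distrib-* b c (suc i) ⟨
        (b * c) * (b * c) ^ i      ≤⟨ *-monoˡ-≤ (<⇒≤ 0<bc) (P-lower-law n i j 1≤bc i≤) ⟩
        (b * c) * (Z ^ n * (b * c) ^ j)
          ≈⟨ solve 3 (λ k z q → k :* (z :* q) := q :* (k :* z)) refl (b * c) (Z ^ n) ((b * c) ^ j) ⟩
        (b * c) ^ j * (b * c * Z ^ n) ∎))
    where
    open ≤-R
    X = P b a
    Y = P c a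
    Z = P (b * c) a
    0≤b = <⇒≤ (1≤⇒0< 1≤b)
    0≤c = <⇒≤ (1≤⇒0< 1≤c)
    1≤bc = 1≤* 1≤b 1≤c
    0<bc = 1≤⇒0< 1≤bc

  P-+ : ∀ {b} a e → 1# ≤ b → P b (a + e) ≈ P b a * P b e
  P-+ {b} a e 1≤b = ≤-antisym
    -- Two integer parts are taken, one for `a` and one for `e`; rounding up instead of down costs
    -- one factor `b` for each, which is where the constant `b * b` comes from.
    (powers-bounded⇒≤ (b * b) (<⇒≤ (*-positive (0<P a 1≤b) (0<P e 1≤b))) λ n →
      integer-part (fromℕ n * a) λ i j i≤ ≤i →
      integer-part (fromℕ n * e) λ k l k≤ ≤k →
      *-cancelˡ-≤ (^-positive (j ℕ.+ l) 0<b) (begin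
        b ^ (j ℕ.+ l) * Z ^ n       ≈⟨ *-comm _ _ ⟩
        Z ^ n * b ^ (j ℕ.+ l)       ≤⟨ P-upper-law n (suc i ℕ.+ suc k) (j ℕ.+ l) 1≤b (≤i+k n i j k l ≤i ≤k) ⟩
        b ^ (suc i ℕ.+ suc k)       ≈⟨ ^-homo-* b (suc i) (suc k) ⟩
        b ^ suc i * b ^ suc k       ≈⟨ solve 3 (λ b p q → (b :* p) :* (b :* q) := b :* b :* (p :* q)) refl b (b ^ i) (b ^ k) ⟩
        b * b * (b ^ i * b ^ k)     ≤⟨ *-monoˡ-≤ (<⇒≤ (*-positive 0<b 0<b)) (*-mono-≤ (^-nonNeg i 0≤b)
                                          (*-nonNegative (^-nonNeg n (0≤P e 1≤b)) (^-nonNeg l 0≤b))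
                                          (P-lower-law n i j 1≤b i≤) (P-lower-law n k l 1≤b k≤)) ⟩
        b * b * ((X ^ n * b ^ j) * (Y ^ n * b ^ l))
          ≈⟨ solve 5 (λ k x p y q → k :* ((x :* p) :* (y :* q)) := (p :* q) :* (k :* (x :* y)))
               refl (b * b) (X ^ n) (b ^ j) (Y ^ n) (b ^ l) ⟩
        (b ^ j * b ^ l) * (b * b * (X ^ n * Y ^ n))
          ≈⟨ *-cong (^-homo-* b j l) (*-congˡ (^-distrib-* X Y n)) ⟨
        b ^ (j ℕ.+ l) * (b * b * (X * Y) ^ n) ∎))
    (powers-bounded⇒≤ (b * b) (0≤P (a + e) 1≤b) λ n →
      integer-part (fromℕ n * a) λ i j i≤ ≤i →
      integer-part (fromℕ n * e) λ k l k≤ ≤k →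
      *-cancelˡ-≤ (^-positive (j ℕ.+ l) 0<b) (begin
        b ^ (j ℕ.+ l) * (X * Y) ^ n ≈⟨ *-cong (^-homo-* b j l) (^-distrib-* X Y n) ⟩
        b ^ j * b ^ l * (X ^ n * Y ^ n)
          ≈⟨ solve 4 (λ x p y q → (p :* q) :* (x :* y) := (x :* p) :* (y :* q))
               refl (X ^ n) (b ^ j) (Y ^ n) (b ^ l) ⟩
        (X ^ n * b ^ j) * (Y ^ n * b ^ l)
          ≤⟨ *-mono-≤ (*-nonNegative (^-nonNeg n (0≤P a 1≤b)) (^-nonNeg j 0≤b))
               (^-nonNeg (suc k) 0≤b)
               (P-upper-law n (suc i) j 1≤b ≤i) (P-upper-law n (suc k) l 1≤b ≤k) ⟩
        b ^ suc i * b ^ suc k       ≈⟨ solve 3 (λ b p q → (b :* p) :* (b :* q) := b :* b :* (p :* q)) refl b (b ^ i) (b ^ k) ⟩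
        b * b * (b ^ i * b ^ k)     ≈⟨ *-congˡ (^-homo-* b i k) ⟨
        b * b * b ^ (i ℕ.+ k)       ≤⟨ *-monoˡ-≤ (<⇒≤ (*-positive 0<b 0<b))
                                        (P-lower-law n (i ℕ.+ k) (j ℕ.+ l) 1≤b (i+k≤ n i j k l i≤ k≤)) ⟩
        b * b * (Z ^ n * b ^ (j ℕ.+ l))
          ≈⟨ solve 3 (λ k z q → k :* (z :* q) := q :* (k :* z)) refl (b * b) (Z ^ n) (b ^ (j ℕ.+ l)) ⟩
        b ^ (j ℕ.+ l) * (b * b * Z ^ n) ∎))
    where
    open ≤-R
    X = P b a
    Y = P b e
    Z = P b (a + e)
    0<b = 1≤⇒0< 1≤b
    0≤b = <⇒≤ 0<b
    regroup : ∀ n j l → fromℕ n * (a + e) + fromℕ (j ℕ.+ l) ≈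
      (fromℕ n * a + fromℕ j) + (fromℕ n * e + fromℕ l)
    regroup n j l = trans (+-congˡ (fromℕ-+ j l))
      (solve 5 (λ n a e j l → n :* (a :+ e) :+ (j :+ l) := (n :* a :+ j) :+ (n :* e :+ l))
        refl (fromℕ n) a e (fromℕ j) (fromℕ l))
    ≤i+k : ∀ n i j k l → fromℕ n * a + fromℕ j ≤ fromℕ (suc i) → fromℕ n * e + fromℕ l ≤ fromℕ (suc k) →
      fromℕ n * (a + e) + fromℕ (j ℕ.+ l) ≤ fromℕ (suc i ℕ.+ suc k)
    ≤i+k n i j k l p q = begin
      fromℕ n * (a + e) + fromℕ (j ℕ.+ l)  ≈⟨ regroup n j l ⟩
      _                                    ≤⟨ +-mono-≤ p q ⟩
      fromℕ (suc i) + fromℕ (suc k)        ≈⟨ fromℕ-+ (suc i) (suc k) ⟨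
      fromℕ (suc i ℕ.+ suc k)              ∎
    i+k≤ : ∀ n i j k l → fromℕ i ≤ fromℕ n * a + fromℕ j → fromℕ k ≤ fromℕ n * e + fromℕ l →
      fromℕ (i ℕ.+ k) ≤ fromℕ n * (a + e) + fromℕ (j ℕ.+ l)
    i+k≤ n i j k l p q = begin
      fromℕ (i ℕ.+ k)                      ≈⟨ fromℕ-+ i k ⟩
      fromℕ i + fromℕ k                    ≤⟨ +-mono-≤ p q ⟩
      _                                    ≈⟨ regroup n j l ⟨
      fromℕ n * (a + e) + fromℕ (j ℕ.+ l)  ∎

-- Weighted means and Bernoulli's inequality for real exponents.

module RealExponents (ℝ : CompleteOrderedField) where
  open CompleteOrderedField ℝ hiding (zero)
  open OrderedField ℝ
  open RealPowers ℝ

  -- The left side is the tangent at `y` to the power n + 1, evaluated at `x`. Multiplying the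
  -- inductive inequality by `x` gives the next tangent plus a nonnegative multiple of (x - y)^2.
  power-tangent : ∀ {x y} n → 0# ≤ x → 0# ≤ y →
    y ^ n * (fromℕ (suc n) * x - fromℕ n * y) ≤ x ^ suc n
  power-tangent {x} {y} zero 0≤x 0≤y = ≤-reflexive
    (solve 2 (λ x y → :1 :* ((:1 :+ :0) :* x :- :0 :* y) := x :* :1) refl x y)
  power-tangent {x} {y} (suc n) 0≤x 0≤y = begin
    y * Y * ((1# + (1# + k)) * x - (1# + k) * y)
      ≤⟨ ≤-by (Y * ((1# + k) * ((x - y) * (x - y))))
           (*-nonNegative (^-nonNeg n 0≤y) (*-nonNegative (fromℕ-nonNeg (suc n)) (square-nonNeg _)))
           (solve 4 (λ x y Y k →
             x :* (Y :* ((:1 :+ k) :* x :- k :* y)) :=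
             y :* Y :* ((:1 :+ (:1 :+ k)) :* x :- (:1 :+ k) :* y)
               :+ Y :* ((:1 :+ k) :* ((x :- y) :* (x :- y)))) refl x y Y k) ⟩
    x * (Y * ((1# + k) * x - k * y))  ≤⟨ *-monoˡ-≤ 0≤x (power-tangent n 0≤x 0≤y) ⟩
    x * x ^ suc n                     ∎
    where
    open ≤-R
    Y = y ^ n
    k = fromℕ n

  weightedMean : ℕ → ℕ → Carrier → Carrier → Carrier
  weightedMean n m x y = (fromℕ (suc n) * x + fromℕ m * y) * fromℕ (m ℕ.+ suc n) ⁻¹

  0<fromℕ[m+1+n] : ∀ n m → 0# < fromℕ (m ℕ.+ suc n)
  0<fromℕ[m+1+n] n m = <-≤-trans (fromℕ-positive n) (fromℕ-mono (ℕ.m≤n+m (suc n) m))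

  weightedMean-nonNeg : ∀ n m {x y} → 0# ≤ x → 0# ≤ y → 0# ≤ weightedMean n m x y
  weightedMean-nonNeg n m 0≤x 0≤y = *-nonNegative
    (+-nonNeg (*-nonNegative (fromℕ-nonNeg (suc n)) 0≤x) (*-nonNegative (fromℕ-nonNeg m) 0≤y))
    (<⇒≤ (⁻¹-positive (0<fromℕ[m+1+n] n m)))

  weightedMean-* : ∀ n m x y →
    fromℕ (m ℕ.+ suc n) * weightedMean n m x y ≈ fromℕ (suc n) * x + fromℕ m * y
  weightedMean-* n m x y = *-⁻¹-cancel _ (0<⇒≉0 (0<fromℕ[m+1+n] n m))

  -- The copies of `y` are added one at a time. If `w` is the mean of K numbers and `z` the mean
  -- after adding `y`, then y = (K + 1) z - K w, so w^K y is exactly the tangent at `w` evaluated at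
  -- `z`.
  weighted-AM-GM : ∀ {x y z} n m → 0# ≤ x → 0# ≤ y → 0# ≤ z →
    fromℕ (m ℕ.+ suc n) * z ≈ fromℕ (suc n) * x + fromℕ m * y →
    x ^ suc n * y ^ m ≤ z ^ (m ℕ.+ suc n)
  weighted-AM-GM {x} {y} {z} n zero 0≤x 0≤y 0≤z eq = ≤-reflexive
    (trans (*-identityʳ _) (^-congˡ (suc n) (sym (*-cancelˡ (0<⇒≉0 (fromℕ-positive n))
      (trans eq (trans (+-congˡ (zeroˡ y)) (+-identityʳ _)))))))
  weighted-AM-GM {x} {y} {z} n (suc m) 0≤x 0≤y 0≤z eq = begin
    x ^ suc n * (y * y ^ m)     ≈⟨ solve 3 (λ p y q → p :* (y :* q) := p :* q :* y) refl (x ^ suc n) y (y ^ m) ⟩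
    x ^ suc n * y ^ m * y       ≤⟨ *-monoʳ-≤ 0≤y (weighted-AM-GM n m 0≤x 0≤y 0≤w (weightedMean-* n m x y)) ⟩
    w ^ K * y                   ≈⟨ *-congˡ y≈ ⟩
    w ^ K * (fromℕ (suc K) * z - fromℕ K * w)  ≤⟨ power-tangent K 0≤z 0≤w ⟩
    z ^ suc K                   ∎
    where
    open ≤-R
    K = m ℕ.+ suc n
    w = weightedMean n m x y
    0≤w = weightedMean-nonNeg n m 0≤x 0≤y
    y≈ : y ≈ fromℕ (suc K) * z - fromℕ K * w
    y≈ = trans (solve 4 (λ s x k y → y := s :* x :+ (:1 :+ k) :* y :- (s :* x :+ k :* y))
                 refl (fromℕ (suc n)) x (fromℕ m) y)
               (+-cong (sym eq) (-‿cong (sym (weightedMean-* n m x y))))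

  1≤x^n*y^m⇒1≤weighted-mean : ∀ {x y} n m → 0# ≤ x → 0# ≤ y → 1# ≤ x ^ suc n * y ^ m →
    fromℕ (suc n) + fromℕ m ≤ fromℕ (suc n) * x + fromℕ m * y
  1≤x^n*y^m⇒1≤weighted-mean {x} {y} n m 0≤x 0≤y 1≤ = begin
    fromℕ (suc n) + fromℕ m               ≈⟨ trans (+-comm _ _) (sym (fromℕ-+ m (suc n))) ⟩
    fromℕ K                               ≈⟨ *-identityʳ _ ⟨
    fromℕ K * 1#                          ≤⟨ *-monoˡ-≤ (fromℕ-nonNeg K) 1≤w ⟩
    fromℕ K * w                           ≈⟨ weightedMean-* n m x y ⟩
    fromℕ (suc n) * x + fromℕ m * y       ∎
    where
    open ≤-R
    K = m ℕ.+ suc n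
    w = weightedMean n m x y
    0≤w = weightedMean-nonNeg n m 0≤x 0≤y
    1≤w : 1# ≤ w
    1≤w = ^-cancelˡ-≤ (m ℕ.+ n) 0≤w (begin
      1# ^ suc (m ℕ.+ n)  ≈⟨ 1^≈1 (suc (m ℕ.+ n)) ⟩
      1#                  ≤⟨ 1≤ ⟩
      x ^ suc n * y ^ m   ≤⟨ weighted-AM-GM n m 0≤x 0≤y 0≤w (weightedMean-* n m x y) ⟩
      w ^ K               ≡⟨ ≡.cong (w ^_) (ℕ.+-suc m n) ⟩
      w ^ suc (m ℕ.+ n)   ∎)

  -- For N ≥ 1 take an integer L with N a ≤ L ≤ 1 + N a. With X the power in question, X^N b^L ≥ 1,
  -- so the weighted mean inequality gives N X + L b ≥ N + L. Hence N times the defect of the claim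
  -- is at most b - 1 for every N, and the defect is not positive.
  P-bernoulli : ∀ {b a} → 1# ≤ b → 0# ≤ a → 1# - a * (b - 1#) ≤ P b (- a)
  P-bernoulli {b} {a} 1≤b 0≤a = 0≤y-x⇒x≤y (≤-respʳ-≈
    (solve 2 (λ x y → :- (x :- y) := y :- x) refl _ X)
    (≤0⇒0≤- (multiples-bounded⇒≤0 {u = b - 1#} bound)))
    where
    open ≤-R
    X = P b (- a)
    0≤b-1 = x≤y⇒0≤y-x 1≤b
    bound : ∀ n → fromℕ n * (1# - a * (b - 1#) - X) ≤ b - 1#
    bound zero    = ≤-respˡ-≈ (sym (zeroˡ _)) 0≤b-1
    bound (suc n) = integer-part (N * a) λ i j i≤ ≤i →
      let j≤1+i = fromℕ-cancel j (suc i) (≤-trans (≤-by (N * a) (*-nonNegative (fromℕ-nonNeg (suc n)) 0≤a)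
                    (+-comm _ _)) ≤i)
          -- This is the integer L above N a, with rounding error at most 1; `j≤1+i` makes the
          -- truncated subtraction exact.
          l = suc i ℕ.∸ j
          L = fromℕ l
          j+l≡ : fromℕ (suc i) ≈ fromℕ j + L
          j+l≡ = trans (reflexive (≡.cong fromℕ (≡.sym (ℕ.m+[n∸m]≡n j≤1+i)))) (fromℕ-+ j l)
          Na≤L : N * a ≤ L
          Na≤L = 0≤y-x⇒x≤y (≤-respʳ-≈ (trans (+-congʳ j+l≡)
            (solve 3 (λ q j l → j :+ l :- (q :+ j) := l :- q) refl (N * a) (fromℕ j) L)) (x≤y⇒0≤y-x ≤i))
          L≤1+Na : L ≤ 1# + N * a
          L≤1+Na = 0≤y-x⇒x≤y (≤-respʳ-≈ (trans
            (solve 4 (λ q j o i → q :+ j :- i := o :+ q :+ j :- (o :+ i)) refl (N * a) (fromℕ j) 1# (fromℕ i))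
            (trans (+-congˡ (-‿cong j+l≡))
              (solve 3 (λ q j l → q :+ j :- (j :+ l) := q :- l) refl (1# + N * a) (fromℕ j) L)))
            (x≤y⇒0≤y-x i≤))
          mean : N + L ≤ N * X + L * b
          mean = 1≤x^n*y^m⇒1≤weighted-mean n l (0≤P (- a) 1≤b) (<⇒≤ (1≤⇒0< 1≤b))
            (P-lower-law (suc n) 0 l 1≤b (≤-respʳ-≈
              (solve 3 (λ n a l → l :- n :* a := n :* (:- a) :+ l) refl N a L) (x≤y⇒0≤y-x Na≤L)))
      in 0≤y-x⇒x≤y (≤-respʳ-≈
           (solve 5 (λ n a b x l →
              (n :* x :+ l :* b :- (n :+ l)) :+ (:1 :+ n :* a :- l) :* (b :- :1)
              := b :- :1 :- n :* (:1 :- a :* (b :- :1) :- x)) refl N a b X L)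
           (+-nonNeg (x≤y⇒0≤y-x mean) (*-nonNegative (x≤y⇒0≤y-x L≤1+Na) 0≤b-1)))
      where N = fromℕ (suc n)

  -- Laws of real powers for arbitrary positive bases.

  ^ℝ-≤0 : ∀ {x} a → x ≤ 0# → x ^ℝ a ≡ 0#
  ^ℝ-≤0 {x} a x≤0 rewrite dec-true (x ≤? 0#) x≤0 = ≡.refl

  ^ℝ-≥1 : ∀ {x} a → 1# ≤ x → x ^ℝ a ≡ P x a
  ^ℝ-≥1 {x} a 1≤x
    rewrite dec-false (x ≤? 0#) (<⇒≱ (1≤⇒0< 1≤x)) | dec-true (1# ≤? x) 1≤x = ≡.refl

  ^ℝ-<1 : ∀ {x} a → 0# < x → x < 1# → x ^ℝ a ≡ P (x ⁻¹) (- a)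
  ^ℝ-<1 {x} a 0<x x<1
    rewrite dec-false (x ≤? 0#) (<⇒≱ 0<x) | dec-false (1# ≤? x) (<⇒≱ x<1) = ≡.refl

  1≤⁻¹ : ∀ {x} → 0# < x → x ≤ 1# → 1# ≤ x ⁻¹
  1≤⁻¹ {x} 0<x x≤1 = *-cancelˡ-≤ 0<x (begin
    x * 1#    ≈⟨ *-identityʳ x ⟩
    x         ≤⟨ x≤1 ⟩
    1#        ≈⟨ ⁻¹-inverseʳ (0<⇒≉0 0<x) ⟨
    x * x ⁻¹  ∎)
    where open ≤-R

  ^ℝ-positive : ∀ {x} a → 0# < x → 0# < x ^ℝ a
  ^ℝ-positive {x} a 0<x with ≤∨> 1# x
  ... | inj₁ 1≤x = ≡.subst (0# <_) (≡.sym (^ℝ-≥1 a 1≤x)) (0<P a 1≤x)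
  ... | inj₂ x<1 = ≡.subst (0# <_) (≡.sym (^ℝ-<1 a 0<x x<1)) (0<P (- a) (1≤⁻¹ 0<x (<⇒≤ x<1)))

  ^ℝ-nonNeg : ∀ x a → 0# ≤ x ^ℝ a
  ^ℝ-nonNeg x a with ≤∨> x 0#
  ... | inj₁ x≤0 = ≤-reflexive (sym (reflexive (^ℝ-≤0 a x≤0)))
  ... | inj₂ 0<x = <⇒≤ (^ℝ-positive a 0<x)

  P-opposite : ∀ {b} a → 1# ≤ b → P b (- a) * P b a ≈ 1#
  P-opposite a 1≤b = trans (sym (P-+ (- a) a 1≤b)) (trans (P-cong 1≤b refl (-‿inverseˡ a)) (P-zero 1≤b))

  -- Writes x as the quotient of x * c and c, both at least 1, so that the laws
  -- of P transfer without distinguishing x < 1 from x ≥ 1.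
  ^ℝ-quotient : ∀ {x c} a → 0# < x → 1# ≤ c → 1# ≤ x * c → x ^ℝ a * P c a ≈ P (x * c) a
  ^ℝ-quotient {x} {c} a 0<x 1≤c 1≤xc with ≤∨> 1# x
  ... | inj₁ 1≤x = trans (*-congʳ (reflexive (^ℝ-≥1 a 1≤x))) (sym (P-* a 1≤x 1≤c))
  ... | inj₂ x<1 = begin
    x ^ℝ a * P c a                              ≡⟨ ≡.cong (_* P c a) (^ℝ-<1 a 0<x x<1) ⟩
    P (x ⁻¹) (- a) * P c a                      ≈⟨ *-congˡ (P-cong 1≤c c≈ refl) ⟩
    P (x ⁻¹) (- a) * P (x ⁻¹ * (x * c)) a       ≈⟨ *-congˡ (P-* a 1≤x⁻¹ 1≤xc) ⟩
    P (x ⁻¹) (- a) * (P (x ⁻¹) a * P (x * c) a) ≈⟨ *-assoc _ _ _ ⟨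
    P (x ⁻¹) (- a) * P (x ⁻¹) a * P (x * c) a   ≈⟨ *-congʳ (P-opposite a 1≤x⁻¹) ⟩
    1# * P (x * c) a                            ≈⟨ *-identityˡ _ ⟩
    P (x * c) a                                 ∎
    where
    open ≈-R
    1≤x⁻¹ = 1≤⁻¹ 0<x (<⇒≤ x<1)
    c≈ : c ≈ x ⁻¹ * (x * c)
    c≈ = sym (trans (solve 3 (λ y x c → y :* (x :* c) := x :* y :* c) refl (x ⁻¹) x c)
      (trans (*-congʳ (⁻¹-inverseʳ (0<⇒≉0 0<x))) (*-identityˡ c)))

  ^ℝ-unique : ∀ {x c y} a → 0# < x → 1# ≤ c → 1# ≤ x * c → y * P c a ≈ P (x * c) a → x ^ℝ a ≈ y
  ^ℝ-unique a 0<x 1≤c 1≤xc eq = *-cancelˡ (0<⇒≉0 (0<P a 1≤c))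
    (trans (*-comm _ _) (trans (^ℝ-quotient a 0<x 1≤c 1≤xc) (trans (sym eq) (*-comm _ _))))

  denominator : ∀ {x} → 0# < x → ∃ λ c → 1# ≤ c × 1# ≤ x * c
  denominator {x} 0<x = 1# + x ⁻¹ ,
    ≤-by (x ⁻¹) (<⇒≤ (⁻¹-positive 0<x)) refl ,
    ≤-by x (<⇒≤ 0<x) (trans (solve 2 (λ x y → x :* (:1 :+ y) := x :* y :+ x) refl x (x ⁻¹))
      (+-congʳ (⁻¹-inverseʳ (0<⇒≉0 0<x))))

  ^ℝ-cong : ∀ {x y a e} → x ≈ y → a ≈ e → x ^ℝ a ≈ y ^ℝ e
  ^ℝ-cong {x} {y} {a} {e} x≈y a≈e with ≤∨> x 0#
  ... | inj₁ x≤0 = reflexive (≡.trans (^ℝ-≤0 a x≤0) (≡.sym (^ℝ-≤0 e (≤-respˡ-≈ x≈y x≤0))))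
  ... | inj₂ 0<x = case denominator 0<x of λ (c , 1≤c , 1≤xc) →
    let 0<y = <-≤-trans 0<x (≤-reflexive x≈y)
        1≤yc = ≤-respʳ-≈ (*-congʳ x≈y) 1≤xc
    in ^ℝ-unique a 0<x 1≤c 1≤xc (begin
         y ^ℝ e * P c a  ≈⟨ *-congˡ (P-cong 1≤c refl a≈e) ⟩
         y ^ℝ e * P c e  ≈⟨ ^ℝ-quotient e 0<y 1≤c 1≤yc ⟩
         P (y * c) e     ≈⟨ P-cong 1≤xc (*-congʳ x≈y) a≈e ⟨
         P (x * c) a     ∎)
    where open ≈-R

  ^ℝ-* : ∀ {x y} a → 0# < x → 0# < y → (x * y) ^ℝ a ≈ x ^ℝ a * y ^ℝ a
  ^ℝ-* {x} {y} a 0<x 0<y =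
    case denominator 0<x of λ (c , 1≤c , 1≤xc) →
    case denominator 0<y of λ (d , 1≤d , 1≤yd) →
    let shuffle : (x * c) * (y * d) ≈ x * y * (c * d)
        shuffle = solve 4 (λ x y c d → (x :* c) :* (y :* d) := x :* y :* (c :* d)) refl x y c d
        1≤xcyd = 1≤* 1≤xc 1≤yd
    in ^ℝ-unique a (*-positive 0<x 0<y) (1≤* 1≤c 1≤d) (≤-respʳ-≈ shuffle 1≤xcyd) (begin
         x ^ℝ a * y ^ℝ a * P (c * d) a            ≈⟨ *-congˡ (P-* a 1≤c 1≤d) ⟩
         x ^ℝ a * y ^ℝ a * (P c a * P d a)        ≈⟨ solve 4 (λ x y c d → x :* y :* (c :* d) := (x :* c) :* (y :* d))
                                                       refl (x ^ℝ a) (y ^ℝ a) (P c a) (P d a) ⟩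
         (x ^ℝ a * P c a) * (y ^ℝ a * P d a)      ≈⟨ *-cong (^ℝ-quotient a 0<x 1≤c 1≤xc) (^ℝ-quotient a 0<y 1≤d 1≤yd) ⟩
         P (x * c) a * P (y * d) a                ≈⟨ P-* a 1≤xc 1≤yd ⟨
         P ((x * c) * (y * d)) a                  ≈⟨ P-cong 1≤xcyd shuffle refl ⟩
         P (x * y * (c * d)) a                    ∎)
    where open ≈-R

  ^ℝ-+ : ∀ {x} a e → 0# < x → x ^ℝ (a + e) ≈ x ^ℝ a * x ^ℝ e
  ^ℝ-+ {x} a e 0<x = case denominator 0<x of λ (c , 1≤c , 1≤xc) →
    ^ℝ-unique (a + e) 0<x 1≤c 1≤xc (begin
      x ^ℝ a * x ^ℝ e * P c (a + e)          ≈⟨ *-congˡ (P-+ a e 1≤c) ⟩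
      x ^ℝ a * x ^ℝ e * (P c a * P c e)      ≈⟨ solve 4 (λ x y c d → x :* y :* (c :* d) := (x :* c) :* (y :* d))
                                                  refl (x ^ℝ a) (x ^ℝ e) (P c a) (P c e) ⟩
      (x ^ℝ a * P c a) * (x ^ℝ e * P c e)    ≈⟨ *-cong (^ℝ-quotient a 0<x 1≤c 1≤xc) (^ℝ-quotient e 0<x 1≤c 1≤xc) ⟩
      P (x * c) a * P (x * c) e              ≈⟨ P-+ a e 1≤xc ⟨
      P (x * c) (a + e)                      ∎)
    where open ≈-R

  ^ℝ-one : ∀ {x} → 0# < x → x ^ℝ 1# ≈ x
  ^ℝ-one {x} 0<x = case denominator 0<x of λ (c , 1≤c , 1≤xc) →
    ^ℝ-unique 1# 0<x 1≤c 1≤xc (trans (*-congˡ (P-one 1≤c)) (sym (P-one 1≤xc)))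

  ^ℝ-suc : ∀ {x} a → 0# < x → x ^ℝ (a + 1#) ≈ x ^ℝ a * x
  ^ℝ-suc a 0<x = trans (^ℝ-+ a 1# 0<x) (*-congˡ (^ℝ-one 0<x))

  1≤^ℝ : ∀ {x a} → 1# ≤ x → 0# ≤ a → 1# ≤ x ^ℝ a
  1≤^ℝ {a = a} 1≤x 0≤a = ≡.subst (1# ≤_) (≡.sym (^ℝ-≥1 a 1≤x)) (1≤P 1≤x 0≤a)

  ^ℝ-mono : ∀ {x y a} → 0# ≤ a → x ≤ y → x ^ℝ a ≤ y ^ℝ a
  ^ℝ-mono {x} {y} {a} 0≤a x≤y with ≤∨> x 0#
  ... | inj₁ x≤0 = ≤-respˡ-≈ (sym (reflexive (^ℝ-≤0 a x≤0))) (^ℝ-nonNeg y a)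
  ... | inj₂ 0<x = begin
    x ^ℝ a                      ≈⟨ *-identityʳ _ ⟨
    x ^ℝ a * 1#                 ≤⟨ *-monoˡ-≤ (^ℝ-nonNeg x a) (1≤^ℝ 1≤q 0≤a) ⟩
    x ^ℝ a * (y * x ⁻¹) ^ℝ a    ≈⟨ ^ℝ-* a 0<x (1≤⇒0< 1≤q) ⟨
    (x * (y * x ⁻¹)) ^ℝ a       ≈⟨ ^ℝ-cong xq≈y refl ⟩
    y ^ℝ a                      ∎
    where
    open ≤-R
    xq≈y = *-⁻¹-cancel y (0<⇒≉0 0<x)
    1≤q : 1# ≤ y * x ⁻¹
    1≤q = *-cancelˡ-≤ 0<x (≤-respʳ-≈ (sym xq≈y) (≤-respˡ-≈ (sym (*-identityʳ x)) x≤y))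

  -- At x = p s this is (p s)^p ≥ 1 + p (s - 1), that is Bernoulli's inequality
  -- for s^p up to the factor p^p that appears in the theorem.
  ^ℝ-bernoulli : ∀ {x p} → 0# ≤ x → 1# < p → x - (p - 1#) ≤ x ^ℝ p
  ^ℝ-bernoulli {x} {p} 0≤x 1<p with x ≈? 0# | ≤∨> 1# x
  ... | yes x≈0 | _ = begin
    x - a         ≈⟨ +-congʳ x≈0 ⟩
    0# - a        ≈⟨ +-identityˡ _ ⟩
    - a           ≤⟨ 0≤⇒-≤0 (x≤y⇒0≤y-x (<⇒≤ 1<p)) ⟩
    0#            ≤⟨ ^ℝ-nonNeg x p ⟩
    x ^ℝ p        ∎
    where open ≤-R
          a = p - 1#
  ... | no _ | inj₁ 1≤x = begin
    x - a         ≤⟨ ≤-by a 0≤a (solve 2 (λ x a → x := x :- a :+ a) refl x a) ⟩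
    x             ≈⟨ *-identityˡ x ⟨
    1# * x        ≤⟨ *-monoʳ-≤ 0≤x (1≤^ℝ 1≤x 0≤a) ⟩
    x ^ℝ a * x    ≈⟨ ^ℝ-suc a (1≤⇒0< 1≤x) ⟨
    x ^ℝ (a + 1#) ≈⟨ ^ℝ-cong refl (solve 2 (λ p o → p :- o :+ o := p) refl p 1#) ⟩
    x ^ℝ p        ∎
    where open ≤-R
          a = p - 1#
          0≤a = x≤y⇒0≤y-x (<⇒≤ 1<p)
  -- Below 1, `x ^ℝ a` unfolds to `P (x ⁻¹) (- a)`, the form bounded by `P-bernoulli`. Multiplying
  -- that bound by `x` gives x + a x - a, from which a x ≥ 0 is dropped.
  ... | no x≉0 | inj₂ x<1 = begin
    x - a                             ≤⟨ ≤-by (a * x) (*-nonNegative 0≤a 0≤x) (solve 2 (λ x a → x :+ a :* x :- a :* :1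
                                            := x :- a :+ a :* x) refl x a) ⟩
    x + a * x - a * 1#                ≈⟨ +-congˡ (-‿cong (*-congˡ (⁻¹-inverseʳ x≉0))) ⟨
    x + a * x - a * (x * x ⁻¹)        ≈⟨ solve 3 (λ x a z → x :+ a :* x :- a :* (x :* z) := (:1 :- a :* (z :- :1)) :* x)
                                           refl x a (x ⁻¹) ⟩
    (1# - a * (x ⁻¹ - 1#)) * x        ≤⟨ *-monoʳ-≤ 0≤x (P-bernoulli (1≤⁻¹ 0<x (<⇒≤ x<1)) 0≤a) ⟩
    P (x ⁻¹) (- a) * x                ≡⟨ ≡.cong (_* x) (^ℝ-<1 a 0<x x<1) ⟨
    x ^ℝ a * x                        ≈⟨ ^ℝ-suc a 0<x ⟨
    x ^ℝ (a + 1#)                     ≈⟨ ^ℝ-cong refl (solve 2 (λ p o → p :- o :+ o := p) refl p 1#) ⟩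
    x ^ℝ p                            ∎
    where open ≤-R
          a = p - 1#
          0≤a = x≤y⇒0≤y-x (<⇒≤ 1<p)
          0<x : 0# < x
          0<x = 0≤x , x≉0 ∘ sym

  -- Absolute values.

  ∣∣-nonNeg : ∀ {x} → 0# ≤ x → ∣ x ∣ ≡ x
  ∣∣-nonNeg {x} p rewrite dec-true (0# ≤? x) p = ≡.refl

  ∣∣-neg : ∀ {x} → ¬ 0# ≤ x → ∣ x ∣ ≡ - x
  ∣∣-neg {x} p rewrite dec-false (0# ≤? x) p = ≡.refl

  ∣∣-nonPos : ∀ {x} → x ≤ 0# → ∣ x ∣ ≈ - x
  ∣∣-nonPos {x} x≤0 with 0# ≤? x
  ... | yes 0≤x = trans x≈0 (trans (sym -0#≈0#) (-‿cong (sym x≈0)))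
    where x≈0 = ≤-antisym x≤0 0≤x
  ... | no  _   = refl

  ∣∣-cong : ∀ {x y} → x ≈ y → ∣ x ∣ ≈ ∣ y ∣
  ∣∣-cong {x} {y} x≈y with 0# ≤? x
  ... | yes p = trans x≈y (sym (reflexive (∣∣-nonNeg (≤-respʳ-≈ x≈y p))))
  ... | no ¬p = trans (-‿cong x≈y) (sym (reflexive (∣∣-neg (¬p ∘ ≤-respʳ-≈ (sym x≈y)))))

  0≤∣∣ : ∀ x → 0# ≤ ∣ x ∣
  0≤∣∣ x with 0# ≤? x
  ... | yes p = p
  ... | no ¬p = ≤0⇒0≤- (≰⇒≥ ¬p)

  ∣-∣ : ∀ x → ∣ - x ∣ ≈ ∣ x ∣
  ∣-∣ x with ≤-total 0# x
  ... | inj₁ p = trans (∣∣-nonPos (0≤⇒-≤0 p))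
                   (trans (solve 1 (λ x → :- (:- x) := x) refl x) (sym (reflexive (∣∣-nonNeg p))))
  ... | inj₂ p = trans (reflexive (∣∣-nonNeg (≤0⇒0≤- p))) (sym (∣∣-nonPos p))

  x≤∣x∣ : ∀ x → x ≤ ∣ x ∣
  x≤∣x∣ x with 0# ≤? x
  ... | yes p = ≤-refl
  ... | no ¬p = ≤-trans (≰⇒≥ ¬p) (≤0⇒0≤- (≰⇒≥ ¬p))

  -x≤∣x∣ : ∀ x → - x ≤ ∣ x ∣
  -x≤∣x∣ x = ≤-respʳ-≈ (∣-∣ x) (x≤∣x∣ (- x))

  ∣∣-least : ∀ {x y} → x ≤ y → - x ≤ y → ∣ x ∣ ≤ y
  ∣∣-least {x} p q with 0# ≤? x
  ... | yes _ = p
  ... | no  _ = q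

  x≉0⇒0<∣x∣ : ∀ {x} → x ≉ 0# → 0# < ∣ x ∣
  x≉0⇒0<∣x∣ {x} x≉0 with ≤-total 0# x
  ... | inj₁ p = ≡.subst (0# <_) (≡.sym (∣∣-nonNeg p)) (p , x≉0 ∘ sym)
  ... | inj₂ p = 0≤∣∣ x , λ 0≈∣x∣ → x≉0 (begin
    x        ≈⟨ solve 1 (λ x → x := :- (:- x)) refl x ⟩
    - - x    ≈⟨ -‿cong (∣∣-nonPos p) ⟨
    - ∣ x ∣  ≈⟨ -‿cong 0≈∣x∣ ⟨
    - 0#     ≈⟨ -0#≈0# ⟩
    0#       ∎)
    where open ≈-R

  ∣x∣*∣x∣≈x*x : ∀ x → ∣ x ∣ * ∣ x ∣ ≈ x * x
  ∣x∣*∣x∣≈x*x x with 0# ≤? x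
  ... | yes _ = refl
  ... | no  _ = solve 1 (λ x → (:- x) :* (:- x) := x :* x) refl x

-- Sums over ordered pairs and drops of a function along walks.

-- The length index serves as the induction measure: the part of a walk kept after the last visit to
-- a vertex lives over a changed relation, so it is not a structural subterm.
data Walk {A : Set} (R : Rel A 0ℓ) : ℕ → Rel A 0ℓ where
  []  : ∀ {x} → Walk R 0 x x
  _∷_ : ∀ {k x y z} → R x y → Walk R k y z → Walk R (suc k) x z

module DoubleSums (ℝ : CompleteOrderedField) where
  open CompleteOrderedField ℝ hiding (zero)
  open OrderedField ℝ
  open SemiringSum semiring public
    using (sum-cong-≋; ∑-distrib-+; ∑-comm; *-distribˡ-sum; *-distribʳ-sum; sum-replicate-zero)

  sum-mono : ∀ {n} {u v : Fin n → Carrier} → (∀ i → u i ≤ v i) → sum u ≤ sum v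
  sum-mono {zero}  u≤v = ≤-refl
  sum-mono {suc n} u≤v = +-mono-≤ (u≤v zero) (sum-mono (u≤v ∘ suc))

  sum-nonNeg : ∀ {n} {u : Fin n → Carrier} → (∀ i → 0# ≤ u i) → 0# ≤ sum u
  sum-nonNeg {n} 0≤u = ≤-respˡ-≈ (sum-replicate-zero n) (sum-mono 0≤u)

  sum-mono-gap : ∀ {n} {u v : Fin n → Carrier} {c} a → (∀ i → u i ≤ v i) → u a + c ≤ v a →
    sum u + c ≤ sum v
  sum-mono-gap {u = u} {v} {c} zero u≤v gap = ≤-respˡ-≈
    (solve 3 (λ a c s → a :+ c :+ s := a :+ s :+ c) refl (u zero) c (sum (u ∘ suc)))
    (+-mono-≤ gap (sum-mono (u≤v ∘ suc)))
  sum-mono-gap (suc a) u≤v gap = ≤-respˡ-≈ (sym (+-assoc _ _ _))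
    (+-mono-≤ (u≤v zero) (sum-mono-gap a (u≤v ∘ suc) gap))

  sum-mono-two-gaps : ∀ {n} {u v : Fin n → Carrier} {c} a b → a ≢ b → (∀ i → u i ≤ v i) →
    u a + c ≤ v a → u b + c ≤ v b → sum u + (c + c) ≤ sum v
  sum-mono-two-gaps zero    zero    a≢b u≤v p q = contradiction ≡.refl a≢b
  sum-mono-two-gaps {u = u} {c = c} zero (suc b) a≢b u≤v p q = ≤-respˡ-≈
    (solve 3 (λ a c s → a :+ c :+ (s :+ c) := a :+ s :+ (c :+ c)) refl (u zero) c (sum (u ∘ suc)))
    (+-mono-≤ p (sum-mono-gap b (u≤v ∘ suc) q))
  sum-mono-two-gaps {u = u} {c = c} (suc a) zero a≢b u≤v p q = ≤-respˡ-≈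
    (solve 3 (λ a c s → a :+ c :+ (s :+ c) := a :+ s :+ (c :+ c)) refl (u zero) c (sum (u ∘ suc)))
    (+-mono-≤ q (sum-mono-gap a (u≤v ∘ suc) p))
  sum-mono-two-gaps (suc a) (suc b) a≢b u≤v p q = ≤-respˡ-≈ (sym (+-assoc _ _ _))
    (+-mono-≤ (u≤v zero) (sum-mono-two-gaps a b (a≢b ∘ ≡.cong suc) (u≤v ∘ suc) p q))

  term≤sum : ∀ {n} {u : Fin n → Carrier} → (∀ i → 0# ≤ u i) → ∀ a → u a ≤ sum u
  term≤sum {n} {u} 0≤u a = ≤-respˡ-≈ (trans (+-congʳ (sum-replicate-zero n)) (+-identityˡ _))
    (sum-mono-gap {u = λ _ → 0#} a 0≤u (≤-reflexive (+-identityˡ (u a))))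

  fromℕ-sum : ∀ {n} (u : Fin n → ℕ) → fromℕ (RawMonoid.sum +-0-rawMonoid u) ≈ sum (fromℕ ∘ u)
  fromℕ-sum {zero}  u = refl
  fromℕ-sum {suc n} u = trans (fromℕ-+ (u zero) _) (+-congˡ (fromℕ-sum (u ∘ suc)))

  maximum : ∀ {n} (u : Fin n → Carrier) → Fin n → ∃ λ m → ∀ i → u i ≤ u m
  maximum {suc zero}    u _ = zero , λ where zero → ≤-refl
  maximum {suc (suc n)} u _ with maximum (u ∘ suc) zero
  ... | m , ≤m with ≤-total (u zero) (u (suc m))
  ...   | inj₁ p = suc m , λ where
    zero    → p
    (suc i) → ≤m i
  ...   | inj₂ p = zero , λ where
    zero    → ≤-refl
    (suc i) → ≤-trans (≤m i) p

  Matrix : ℕ → Set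
  Matrix n = Fin n → Fin n → Carrier

  ∬ : ∀ {n} → Matrix n → Carrier
  ∬ w = sum λ x → sum λ y → w x y

  ∬-cong : ∀ {n} {w z : Matrix n} → (∀ x y → w x y ≈ z x y) → ∬ w ≈ ∬ z
  ∬-cong w≈z = sum-cong-≋ λ x → sum-cong-≋ (w≈z x)

  ∬-mono : ∀ {n} {w z : Matrix n} → (∀ x y → w x y ≤ z x y) → ∬ w ≤ ∬ z
  ∬-mono w≤z = sum-mono λ x → sum-mono (w≤z x)

  ∬-nonNeg : ∀ {n} {w : Matrix n} → (∀ x y → 0# ≤ w x y) → 0# ≤ ∬ w
  ∬-nonNeg 0≤w = sum-nonNeg λ x → sum-nonNeg (0≤w x)

  ∬-zero : ∀ {n} {w : Matrix n} → (∀ x y → w x y ≈ 0#) → ∬ w ≈ 0#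
  ∬-zero {n} {w} w≈0 = trans (sum-cong-≋ rows≈0) (sum-replicate-zero n)
    where
    rows≈0 : ∀ x → sum (w x) ≈ 0#
    rows≈0 x = trans (sum-cong-≋ (w≈0 x)) (sum-replicate-zero n)

  ∬-+ : ∀ {n} (w z : Matrix n) → ∬ (λ x y → w x y + z x y) ≈ ∬ w + ∬ z
  ∬-+ w z = trans (sum-cong-≋ λ x → ∑-distrib-+ (w x) (z x))
    (∑-distrib-+ (λ x → sum (w x)) (λ x → sum (z x)))

  ∬-* : ∀ {n} k (w : Matrix n) → ∬ (λ x y → k * w x y) ≈ k * ∬ w
  ∬-* k w = sym (trans (*-distribˡ-sum k (λ x → sum (w x)))
    (sum-cong-≋ λ x → *-distribˡ-sum k (w x)))

  ∬-transpose : ∀ {n} (w : Matrix n) → ∬ w ≈ ∬ (λ x y → w y x)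
  ∬-transpose w = ∑-comm w

  ∬-symmetrise : ∀ {n} (w : Matrix n) → ∬ (λ x y → w x y + w y x) ≈ ∬ w + ∬ w
  ∬-symmetrise w = trans (∬-+ w (λ x y → w y x)) (+-congˡ (sym (∬-transpose w)))

  Mask : ℕ → Set
  Mask n = Fin n → Fin n → Bool

  -- Pairs already charged are given weight zero rather than being removed from the graph, so one
  -- index set serves throughout the induction along a walk.
  erase : ∀ {n} → Mask n → Matrix n → Matrix n
  erase D w x y = if D x y then 0# else w x y

  erase-nonNeg : ∀ {n} (D : Mask n) {w} → (∀ x y → 0# ≤ w x y) → ∀ x y → 0# ≤ erase D w x y
  erase-nonNeg D 0≤w x y with D x y
  ... | true  = ≤-refl
  ... | false = 0≤w x y

  erase-≤ : ∀ {n} (D : Mask n) {w} → (∀ x y → 0# ≤ w x y) → ∀ x y → erase D w x y ≤ w x y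
  erase-≤ D 0≤w x y with D x y
  ... | true  = 0≤w x y
  ... | false = ≤-refl

  erase-sym : ∀ {n} (D : Mask n) {w} → (∀ x y → D x y ≡ D y x) → (∀ x y → w x y ≈ w y x) →
    ∀ x y → erase D w x y ≈ erase D w y x
  erase-sym D D-sym w-sym x y rewrite D-sym x y with D y x
  ... | true  = refl
  ... | false = w-sym x y

  -- A symmetric mask erases both (a, b) and (b, a). Since a and b differ, these entries lie in
  -- different rows and their weights are recovered separately.
  ∬-erase : ∀ {n} (D : Mask n) {w : Matrix n} {a b} → (∀ x y → D x y ≡ D y x) →
    (∀ x y → 0# ≤ w x y) → (∀ x y → w x y ≈ w y x) → a ≢ b → D a b ≡ true →
    ∬ (erase D w) + (w a b + w a b) ≤ ∬ w
  ∬-erase D {w} {a} {b} D-sym 0≤w w-sym a≢b Dab =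
    sum-mono-two-gaps a b a≢b (λ x → sum-mono (erase-≤ D 0≤w x))
      (sum-mono-gap b (erase-≤ D 0≤w a) (gap Dab refl))
      (sum-mono-gap a (erase-≤ D 0≤w b) (gap (≡.trans (D-sym b a) Dab) (w-sym a b)))
    where
    gap : ∀ {x y c} → D x y ≡ true → c ≈ w x y → erase D w x y + c ≤ w x y
    gap Dxy c≈ rewrite Dxy = ≤-reflexive (trans (+-identityˡ _) c≈)

  incident : ∀ {n} → Fin n → Mask n
  incident v x y = does (x Fin.≟ v) ∨ does (y Fin.≟ v)

  incident-sym : ∀ {n} (v x y : Fin n) → incident v x y ≡ incident v y x
  incident-sym v x y = Bool.∨-comm (does (x Fin.≟ v)) _

  incident-true : ∀ {n} (v y : Fin n) → incident v v y ≡ true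
  incident-true v y rewrite dec-true (v Fin.≟ v) ≡.refl = ≡.refl

  incident-false : ∀ {n} {v x y : Fin n} → x ≢ v → y ≢ v → incident v x y ≡ false
  incident-false {v = v} {x} {y} x≢v y≢v
    rewrite dec-false (x Fin.≟ v) x≢v | dec-false (y Fin.≟ v) y≢v = ≡.refl

  edgeMask : ∀ {n} → Fin n → Fin n → Mask n
  edgeMask a b x y = does (x Fin.≟ a) ∧ does (y Fin.≟ b) ∨ does (x Fin.≟ b) ∧ does (y Fin.≟ a)

  edgeMask-sym : ∀ {n} (a b x y : Fin n) → edgeMask a b x y ≡ edgeMask a b y x
  edgeMask-sym a b x y = ≡.trans (Bool.∨-comm (does (x Fin.≟ a) ∧ does (y Fin.≟ b)) _)
    (≡.cong₂ _∨_ (Bool.∧-comm (does (x Fin.≟ b)) _) (Bool.∧-comm (does (x Fin.≟ a)) _))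

  edgeMask-true : ∀ {n} (a b : Fin n) → edgeMask a b a b ≡ true
  edgeMask-true a b rewrite dec-true (a Fin.≟ a) ≡.refl | dec-true (b Fin.≟ b) ≡.refl = ≡.refl

  edgeMask-false : ∀ {n} {a b x : Fin n} y → x ≢ a → x ≢ b → edgeMask a b x y ≡ false
  edgeMask-false {a = a} {b} {x} y x≢a x≢b
    rewrite dec-false (x Fin.≟ a) x≢a | dec-false (x Fin.≟ b) x≢b = ≡.refl

  -- A step records only this inequality and not adjacency, so it survives any erasing that leaves
  -- its own entry alone.
  Drop : ∀ {n} → (Fin n → Carrier) → Matrix n → Rel (Fin n) 0ℓ
  Drop g w x y = g x ≤ g y + w x y

  drop-erase : ∀ {n} {g : Fin n → Carrier} {w} (D : Mask n) {x y} → D x y ≡ false →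
    Drop g w x y → Drop g (erase D w) x y
  drop-erase D Dxy rewrite Dxy = λ p → p

  module _ {n} {g : Fin n → Carrier} where

    -- The part of a walk after its last visit to v.
    lastExit : ∀ {w k x y} v → Walk (Drop g w) k x y →
      v ≡ y ⊎
      (∃₂ λ l z → l ℕ.< k × z ≢ v × Drop g w v z × Walk (Drop g (erase (incident v) w)) l z y) ⊎
      (x ≢ v × Walk (Drop g (erase (incident v) w)) k x y)
    lastExit {x = x} v [] with x Fin.≟ v
    ... | yes x≡v = inj₁ (≡.sym x≡v)
    ... | no  x≢v = inj₂ (inj₂ (x≢v , []))
    lastExit {w} {x = x} v (_∷_ {y = u} d ds) with lastExit v ds
    ... | inj₁ v≡y = inj₁ v≡y
    ... | inj₂ (inj₁ (l , z , l<k , rest)) = inj₂ (inj₁ (l , z , ℕ.m<n⇒m<1+n l<k , rest))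
    ... | inj₂ (inj₂ (z≢v , es)) with x Fin.≟ v
    ...   | yes ≡.refl = inj₂ (inj₁ (_ , _ , ℕ.n<1+n _ , z≢v , d , es))
    ...   | no  x≢v    = inj₂ (inj₂ (x≢v , drop-erase {g = g} {w} (incident v) {x} {u} (incident-false x≢v z≢v) d ∷ es))

    -- Every unordered pair is counted twice in ∬ w, and erasing a vertex once
    -- it has been left for good makes sure no pair is charged twice.
    walk-drop : ∀ {w} N {k x y} → k ℕ.≤ N → (∀ x y → 0# ≤ w x y) → (∀ x y → w x y ≈ w y x) →
      Walk (Drop g w) k x y → g x + g x ≤ (g y + g y) + ∬ w
    walk-drop {w} N {k} {x} {y} k≤N 0≤w w-sym ds with lastExit x ds
    ... | inj₁ ≡.refl = ≤-by (∬ w) (∬-nonNeg 0≤w) refl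
    ... | inj₂ (inj₂ (x≢x , _)) = contradiction ≡.refl x≢x
    walk-drop zero    ℕ.z≤n 0≤w w-sym ds | inj₂ (inj₁ (l , z , () , _))
    walk-drop {w} (suc N) {k} {x} {y} k≤N 0≤w w-sym ds | inj₂ (inj₁ (l , z , l<k , z≢x , d , es)) = begin
      g x + g x                                   ≤⟨ +-mono-≤ d d ⟩
      (g z + w x z) + (g z + w x z)               ≈⟨ solve 2 (λ a b → (a :+ b) :+ (a :+ b) := (a :+ a) :+ (b :+ b))
                                                        refl (g z) (w x z) ⟩
      (g z + g z) + (w x z + w x z)               ≤⟨ +-mono-≤ (walk-drop N (ℕ.≤-pred (ℕ.≤-trans l<k k≤N))
                                                       (erase-nonNeg D 0≤w)
                                                       (erase-sym D (incident-sym x) w-sym) es) ≤-refl ⟩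
      ((g y + g y) + ∬ (erase D w)) + (w x z + w x z) ≈⟨ +-assoc _ _ _ ⟩
      (g y + g y) + (∬ (erase D w) + (w x z + w x z)) ≤⟨ +-monoʳ-≤ _ (∬-erase D (incident-sym x) 0≤w w-sym
                                                           (z≢x ∘ ≡.sym) (incident-true x z)) ⟩
      (g y + g y) + ∬ w                           ∎
      where open ≤-R
            D = incident x

    module _ {w : Matrix n} {_~_ : Rel (Fin n) 0ℓ} (drop : ∀ {x y} → x ~ y → Drop g w x y) (a b : Fin n) where

      -- Every step before the first visit to `a` or `b` starts at neither of them, so it does not
      -- cross the pair and keeps its weight after that pair is erased.
      firstHit : ∀ {x} → Star _~_ x a →
        ∃₂ λ k z → (z ≡ a ⊎ z ≡ b) × Walk (Drop g (erase (edgeMask a b) w)) k x z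
      firstHit ε = 0 , a , inj₁ ≡.refl , []
      firstHit {x} (_◅_ {j = y} e es) with x Fin.≟ a | x Fin.≟ b
      ... | yes x≡a | _       = 0 , x , inj₁ x≡a , []
      ... | no  _   | yes x≡b = 0 , x , inj₂ x≡b , []
      ... | no  x≢a | no x≢b with firstHit es
      ...   | k , z , z∈ , ds =
        suc k , z , z∈ , drop-erase {g = g} {w} (edgeMask a b) {x} {y} (edgeMask-false y x≢a x≢b) (drop e) ∷ ds

      -- The walk ends at an endpoint z of the pair without spending the weight of the pair. Since g
      -- z ≤ g a + g b ≤ w a b, the remaining 2 g z is covered by the two erased entries.
      ∬-edge-bound : ∀ {x} → (∀ x y → 0# ≤ w x y) → (∀ x y → w x y ≈ w y x) →
        (∀ x → 0# ≤ g x) → a ≢ b → g a + g b ≤ w a b → Star _~_ x a → g x + g x ≤ ∬ w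
      ∬-edge-bound {x} 0≤w w-sym 0≤g a≢b ga+gb≤ xs with firstHit xs
      ... | k , z , z∈ , ds = begin
        g x + g x                                ≤⟨ walk-drop k ℕ.≤-refl (erase-nonNeg D 0≤w)
                                                      (erase-sym D (edgeMask-sym a b) w-sym) ds ⟩
        (g z + g z) + ∬ (erase D w)              ≤⟨ +-mono-≤ (+-mono-≤ gz≤ gz≤) ≤-refl ⟩
        (w a b + w a b) + ∬ (erase D w)          ≈⟨ +-comm _ _ ⟩
        ∬ (erase D w) + (w a b + w a b)          ≤⟨ ∬-erase D (edgeMask-sym a b) 0≤w w-sym a≢b (edgeMask-true a b) ⟩
        ∬ w                                      ∎
        where
        open ≤-R
        D = edgeMask a b
        gz≤ : g z ≤ w a b
        gz≤ = case z∈ of λ where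
          (inj₁ ≡.refl) → ≤-trans (≤-by (g b) (0≤g b) refl) ga+gb≤
          (inj₂ ≡.refl) → ≤-trans (≤-by (g a) (0≤g a) (+-comm _ _)) ga+gb≤

-- Signs and opposite values.

module SignLemmas (ℝ : CompleteOrderedField) where
  open CompleteOrderedField ℝ hiding (zero)
  open OrderedField ℝ
  open RealExponents ℝ

  ◃-cong : ∀ s {x y} → x ≈ y → s ◃ x ≈ s ◃ y
  ◃-cong Sign.+ eq = eq
  ◃-cong Sign.- eq = -‿cong eq

  ∣◃∣ : ∀ s x → ∣ s ◃ x ∣ ≈ ∣ x ∣
  ∣◃∣ Sign.+ x = refl
  ∣◃∣ Sign.- x = ∣-∣ x

  *-◃ : ∀ s x y → x * (s ◃ y) ≈ s ◃ (x * y)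
  *-◃ Sign.+ x y = refl
  *-◃ Sign.- x y = solve 2 (λ x y → x :* (:- y) := :- (x :* y)) refl x y

  sgn : Carrier → Sign
  sgn x = if does (0# ≤? x) then Sign.+ else Sign.-

  sgn-◃-nonNeg : ∀ x → 0# ≤ sgn x ◃ x
  sgn-◃-nonNeg x with 0# ≤? x
  ... | yes p = p
  ... | no ¬p = ≤0⇒0≤- (≰⇒≥ ¬p)

  sgn-◃-positive : ∀ {x} → x ≉ 0# → 0# < sgn x ◃ x
  sgn-◃-positive {x} x≉0 = sgn-◃-nonNeg x , λ 0≈ → x≉0 (cancel (sgn x) (sym 0≈))
    where
    cancel : ∀ s → s ◃ x ≈ 0# → x ≈ 0#
    cancel Sign.+ eq = eq
    cancel Sign.- eq = trans (solve 1 (λ x → x := :- (:- x)) refl x) (trans (-‿cong eq) -0#≈0#)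

  ∣x∣≤∣y∣+∣x-y∣ : ∀ x y → ∣ x ∣ ≤ ∣ y ∣ + ∣ x - y ∣
  ∣x∣≤∣y∣+∣x-y∣ x y = ∣∣-least
    (≤-respˡ-≈ (solve 2 (λ x y → y :+ (x :- y) := x) refl x y) (+-mono-≤ (x≤∣x∣ y) (x≤∣x∣ (x - y))))
    (≤-respˡ-≈ (solve 2 (λ x y → :- y :+ :- (x :- y) := :- x) refl x y) (+-mono-≤ (-x≤∣x∣ y) (-x≤∣x∣ (x - y))))

  x*y≤0⇒opposite : ∀ {x y} → x * y ≤ 0# → (0# ≤ x × y ≤ 0#) ⊎ (x ≤ 0# × 0# ≤ y)
  x*y≤0⇒opposite {x} {y} xy≤0 with ≤∨> x 0# | ≤∨> y 0#
  ... | inj₁ x≤0 | inj₂ 0<y = inj₂ (x≤0 , <⇒≤ 0<y)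
  ... | inj₂ 0<x | inj₁ y≤0 = inj₁ (<⇒≤ 0<x , y≤0)
  ... | inj₂ 0<x | inj₂ 0<y = contradiction xy≤0 (<⇒≱ (*-positive 0<x 0<y))
  -- Two strictly negative factors would have a positive product, so one of the two numbers is also
  -- nonnegative.
  ... | inj₁ x≤0 | inj₁ y≤0 with 0# ≤? x | 0# ≤? y
  ...   | yes 0≤x | _       = inj₁ (0≤x , y≤0)
  ...   | no  _   | yes 0≤y = inj₂ (x≤0 , 0≤y)
  ...   | no ¬0≤x | no ¬0≤y = contradiction xy≤0 (<⇒≱ (<-≤-trans
    (*-positive (negate (≰⇒> ¬0≤x)) (negate (≰⇒> ¬0≤y)))
    (≤-reflexive (solve 2 (λ x y → (:0 :- x) :* (:0 :- y) := x :* y) refl x y))))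
    where
    negate : ∀ {z} → z < 0# → 0# < 0# - z
    negate = <⇒0<-

  x*y≤0⇒∣x∣+∣y∣≤∣x-y∣ : ∀ {x y} → x * y ≤ 0# → ∣ x ∣ + ∣ y ∣ ≤ ∣ x - y ∣
  x*y≤0⇒∣x∣+∣y∣≤∣x-y∣ {x} {y} xy≤0 with x*y≤0⇒opposite xy≤0
  ... | inj₁ (0≤x , y≤0) = ≤-respˡ-≈
    (+-cong (sym (reflexive (∣∣-nonNeg 0≤x))) (sym (∣∣-nonPos y≤0))) (x≤∣x∣ (x - y))
  ... | inj₂ (x≤0 , 0≤y) = ≤-respˡ-≈
    (trans (solve 2 (λ x y → :- (x :- y) := :- x :+ y) refl x y)
      (+-cong (sym (∣∣-nonPos x≤0)) (sym (reflexive (∣∣-nonNeg 0≤y))))) (-x≤∣x∣ (x - y))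

  x+x≈0⇒x≈0 : ∀ {x} → x + x ≈ 0# → x ≈ 0#
  x+x≈0⇒x≈0 {x} eq = *-cancelˡ (0<⇒≉0 (+-positiveˡ 0<1 0≤1))
    (trans (solve 1 (λ x → (:1 :+ :1) :* x := x :+ x) refl x) (trans eq (sym (zeroʳ _))))

-- The nonlinearity `φ`, adjacency and degrees.

module Eigenfunctions (ℝ : CompleteOrderedField) (G : SimpleGraph) (S : Signature G) where
  open CompleteOrderedField ℝ hiding (zero)
  open OrderedField ℝ
  open RealExponents ℝ
  open DoubleSums ℝ
  open SignLemmas ℝ
  open SimpleGraph G
  open Signature S
  open SignedPLaplacian ℝ G S

  φ-cong : ∀ p {s t} → s ≈ t → φ p s ≈ φ p t
  φ-cong p s≈t = *-cong (^ℝ-cong (∣∣-cong s≈t) refl) s≈t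

  φ-neg : ∀ p t → φ p (- t) ≈ - φ p t
  φ-neg p t = trans (*-congʳ (^ℝ-cong (∣-∣ t) refl))
    (solve 2 (λ a t → a :* (:- t) := :- (a :* t)) refl (∣ t ∣ ^ℝ (p - 2#)) t)

  φ-zero : ∀ p → φ p 0# ≈ 0#
  φ-zero p = zeroʳ _

  φ-≉0 : ∀ p {t} → t ≉ 0# → φ p t ≉ 0#
  φ-≉0 p t≉0 = *-≉0 (0<⇒≉0 (^ℝ-positive _ (x≉0⇒0<∣x∣ t≉0))) t≉0

  ∣0∣^ℝ : ∀ {t} a → t ≈ 0# → ∣ t ∣ ^ℝ a ≈ 0#
  ∣0∣^ℝ a t≈0 = reflexive (^ℝ-≤0 a (≤-reflexive (trans (∣∣-cong t≈0) (reflexive (∣∣-nonNeg ≤-refl)))))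

  φ-* : ∀ p t → φ p t * t ≈ ∣ t ∣ ^ℝ p
  φ-* p t with t ≈? 0#
  ... | yes t≈0 = trans (*-congˡ t≈0) (trans (zeroʳ _) (sym (∣0∣^ℝ p t≈0)))
  ... | no  t≉0 = begin
    a * t * t              ≈⟨ *-assoc _ _ _ ⟩
    a * (t * t)            ≈⟨ *-congˡ (∣x∣*∣x∣≈x*x t) ⟨
    a * (∣ t ∣ * ∣ t ∣)    ≈⟨ *-assoc _ _ _ ⟨
    a * ∣ t ∣ * ∣ t ∣      ≈⟨ *-congʳ (^ℝ-suc (p - 2#) 0<∣t∣) ⟨
    ∣ t ∣ ^ℝ (p - 2# + 1#) * ∣ t ∣  ≈⟨ ^ℝ-suc (p - 2# + 1#) 0<∣t∣ ⟨
    ∣ t ∣ ^ℝ (p - 2# + 1# + 1#)     ≈⟨ ^ℝ-cong refl (solve 1 (λ p → p :- (:1 :+ :1) :+ :1 :+ :1 := p) refl p) ⟩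
    ∣ t ∣ ^ℝ p             ∎
    where open ≈-R
          a = ∣ t ∣ ^ℝ (p - 2#)
          0<∣t∣ = x≉0⇒0<∣x∣ t≉0

  -- Adjacency may have several proofs; `undirected` compares each of them with the same reversed
  -- edge.
  σ-irrelevant : ∀ {x y} (e e′ : x ~ y) → σ e ≡ σ e′
  σ-irrelevant e e′ = ≡.trans (undirected e (~-sym e)) (≡.sym (undirected e′ (~-sym e)))

  edgeValue : ∀ {x y} → (x ~ y → Carrier) → Dec (x ~ y) → Carrier
  edgeValue g (yes e) = g e
  edgeValue g (no _)  = 0#

  -- Reads off the summation function of a sum, here the one of sumNeighbours,
  -- whose local function `term` cannot be named.
  summand : ∀ {n} {u : Fin n → Carrier} {s} → s ≡ sum u → Fin n → Carrier
  summand {u = u} _ = u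

  sumNeighbours-edgeValue : ∀ x (g : ∀ {y} → x ~ y → Carrier) →
    sumNeighbours x g ≈ sum (λ y → edgeValue g (x ~? y))
  sumNeighbours-edgeValue x g = sum-cong-≋ pointwise
    where
    pointwise : ∀ y → summand {s = sumNeighbours x g} ≡.refl y ≈ edgeValue g (x ~? y)
    pointwise y with x ~? y
    ... | yes _ = refl
    ... | no  _ = refl

  adjacency : Matrix order
  adjacency x y = if does (x ~? y) then 1# else 0#

  adjacency-nonNeg : ∀ x y → 0# ≤ adjacency x y
  adjacency-nonNeg x y with x ~? y
  ... | yes _ = 0≤1
  ... | no  _ = ≤-refl

  degree-sum : ∀ x → fromℕ (degree x) ≈ sum (adjacency x)
  degree-sum x = trans (fromℕ-sum (λ y → if does (x ~? y) then 1 else 0)) (sum-cong-≋ pointwise)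
    where
    pointwise : ∀ y → fromℕ (if does (x ~? y) then 1 else 0) ≈ adjacency x y
    pointwise y with x ~? y
    ... | yes _ = +-identityʳ 1#
    ... | no  _ = refl

  vol-sum : fromℕ vol ≈ ∬ adjacency
  vol-sum = trans (fromℕ-sum degree) (sum-cong-≋ degree-sum)

  1≤degree : ∀ {x y} → x ~ y → 1# ≤ fromℕ (degree x)
  1≤degree {x} {y} e = begin
    1#                 ≡⟨ ≡.cong (λ b → if b then 1# else 0#) (dec-true (x ~? y) e) ⟨
    adjacency x y      ≤⟨ term≤sum (adjacency-nonNeg x) y ⟩
    sum (adjacency x)  ≈⟨ degree-sum x ⟨
    fromℕ (degree x)   ∎
    where open ≤-R

  -- Signed differences along edges.

  module _ (f : V → Carrier) where

    δ : Matrix order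
    δ x y = edgeValue (λ e → f x - (σ e ◃ f y)) (x ~? y)

    δ-edge : ∀ {x y} (e : x ~ y) → δ x y ≡ f x - (σ e ◃ f y)
    δ-edge {x} {y} e with x ~? y
    ... | yes e′ = ≡.cong (λ s → f x - (s ◃ f y)) (σ-irrelevant e′ e)
    ... | no ¬e  = contradiction e ¬e

    δ-nonEdge : ∀ {x y} → ¬ x ~ y → δ x y ≡ 0#
    δ-nonEdge {x} {y} ¬e with x ~? y
    ... | yes e = contradiction e ¬e
    ... | no  _ = ≡.refl

    -- From σ^2 = 1: f y - σ f x = -σ (f x - σ f y). This makes ∣δ∣ symmetric and, `φ` being odd,
    -- governs both tests of the equation.
    δ-reverse : ∀ {x y} (e : x ~ y) → δ y x ≈ - (σ e ◃ δ x y)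
    δ-reverse {x} {y} e rewrite δ-edge e | δ-edge (~-sym e) | ≡.sym (undirected e (~-sym e)) with σ e
    ... | Sign.+ = solve 2 (λ a b → b :- a := :- (a :- b)) refl (f x) (f y)
    ... | Sign.- = solve 2 (λ a b → b :- (:- a) := :- (:- (a :- (:- b)))) refl (f x) (f y)

    φ-reverse : ∀ p {x y} (e : x ~ y) → φ p (δ y x) ≈ - (σ e ◃ φ p (δ x y))
    φ-reverse p {x} {y} e = trans (φ-cong p (δ-reverse e)) (lemma (σ e))
      where
      lemma : ∀ s → φ p (- (s ◃ δ x y)) ≈ - (s ◃ φ p (δ x y))
      lemma Sign.+ = φ-neg p _
      lemma Sign.- = trans (φ-neg p _) (-‿cong (φ-neg p _))

    ∣δ∣ : Matrix order
    ∣δ∣ x y = ∣ δ x y ∣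

    ∣δ∣-sym : ∀ x y → ∣δ∣ x y ≈ ∣δ∣ y x
    ∣δ∣-sym x y with x ~? y in eq
    ... | yes e = sym (trans (∣∣-cong (δ-reverse e)) (trans (∣-∣ _) (trans (∣◃∣ (σ e) _)
                    (reflexive (≡.cong (λ d → ∣ edgeValue (λ e → f x - (σ e ◃ f y)) d ∣) eq)))))
    ... | no ¬e = ∣∣-cong (reflexive (≡.sym (δ-nonEdge (¬e ∘ ~-sym))))

    ∣f∣-drop : ∀ {x y} → x ~ y → Drop (∣_∣ ∘ f) ∣δ∣ x y
    ∣f∣-drop {x} {y} e = begin
      ∣ f x ∣                                          ≤⟨ ∣x∣≤∣y∣+∣x-y∣ (f x) (σ e ◃ f y) ⟩
      ∣ σ e ◃ f y ∣ + ∣ f x - (σ e ◃ f y) ∣            ≈⟨ +-cong (∣◃∣ (σ e) (f y)) (reflexive (≡.cong ∣_∣ (≡.sym (δ-edge e)))) ⟩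
      ∣ f y ∣ + ∣ δ x y ∣                              ∎
      where open ≤-R

    Frustrated : V → V → Set
    Frustrated x y = ∃ λ (e : x ~ y) → f x * (σ e ◃ f y) ≤ 0#

    frustrated? : ∀ x y → Dec (Frustrated x y)
    frustrated? x y with x ~? y
    ... | no ¬e = no (¬e ∘ proj₁)
    ... | yes e with f x * (σ e ◃ f y) ≤? 0#
    ...   | yes p = yes (e , p)
    ...   | no ¬p = no λ (e′ , p) → ¬p (≡.subst (λ s → f x * (s ◃ f y) ≤ 0#) (σ-irrelevant e′ e) p)

    frustrated⇒total-variation : Connected → ∀ {a b} → Frustrated a b → ∀ x →
      ∣ f x ∣ + ∣ f x ∣ ≤ ∬ ∣δ∣
    frustrated⇒total-variation connected {a} {b} (e , p) x =
      ∬-edge-bound ∣f∣-drop a b (λ x y → 0≤∣∣ _) ∣δ∣-sym (λ x → 0≤∣∣ _)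
        (λ a≡b → ~-irrefl (≡.subst (_~ b) a≡b e)) fa+fb≤ (connected x a)
      where
      open ≤-R
      fa+fb≤ : ∣ f a ∣ + ∣ f b ∣ ≤ ∣δ∣ a b
      fa+fb≤ = begin
        ∣ f a ∣ + ∣ f b ∣          ≈⟨ +-congˡ (∣◃∣ (σ e) (f b)) ⟨
        ∣ f a ∣ + ∣ σ e ◃ f b ∣    ≤⟨ x*y≤0⇒∣x∣+∣y∣≤∣x-y∣ p ⟩
        ∣ f a - (σ e ◃ f b) ∣      ≡⟨ ≡.cong ∣_∣ (δ-edge e) ⟨
        ∣ δ a b ∣                  ∎

  -- Consequences of the eigenvalue equation.

  module _ {p μ : Carrier} {f : V → Carrier}
    (eigen : ∀ x → - Δ p f x ≈ μ * φ p (f x)) (μ≉0 : μ ≉ 0#) where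

    neighbours-φδ : ∀ x → sumNeighbours x (λ {y} e → φ p ((σ e ◃ f y) - f x)) ≈
      - sum (λ y → φ p (δ f x y))
    neighbours-φδ x = begin
      sumNeighbours x _                           ≈⟨ sumNeighbours-edgeValue x _ ⟩
      sum (λ y → edgeValue _ (x ~? y))            ≈⟨ sum-cong-≋ pointwise ⟩
      sum (λ y → - 1# * φ p (δ f x y))            ≈⟨ *-distribˡ-sum (- 1#) (λ y → φ p (δ f x y)) ⟨
      - 1# * sum (λ y → φ p (δ f x y))            ≈⟨ solve 1 (λ s → :- :1 :* s := :- s) refl _ ⟩
      - sum (λ y → φ p (δ f x y))                 ∎
      where
      open ≈-R
      pointwise : ∀ y → edgeValue (λ e → φ p ((σ e ◃ f y) - f x)) (x ~? y) ≈ - 1# * φ p (δ f x y)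
      pointwise y with x ~? y
      ... | no  _ = sym (trans (*-congˡ (φ-zero p)) (zeroʳ _))
      ... | yes e = begin
        φ p ((σ e ◃ f y) - f x)            ≈⟨ φ-cong p (solve 2 (λ a b → b :- a := :- (a :- b)) refl (f x) (σ e ◃ f y)) ⟩
        φ p (- (f x - (σ e ◃ f y)))        ≈⟨ φ-neg p _ ⟩
        - φ p (f x - (σ e ◃ f y))          ≈⟨ solve 1 (λ s → :- s := :- :1 :* s) refl _ ⟩
        - 1# * φ p (f x - (σ e ◃ f y))     ∎

    -- The empty neighbour sum is zero whatever value the inverse of the degree 0 has, so the
    -- equation becomes μ φ(f x) = 0 with μ nonzero.
    isolated⇒zero : ∀ {x} → ¬ (∃ λ y → x ~ y) → f x ≈ 0#
    isolated⇒zero {x} isolated = case f x ≈? 0# of λ where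
        (yes fx≈0) → fx≈0
        (no  fx≉0) → contradiction μφ≈0 (*-≉0 μ≉0 (φ-≉0 p fx≉0))
      where
      open ≈-R
      μφ≈0 : μ * φ p (f x) ≈ 0#
      μφ≈0 = begin
        μ * φ p (f x)                       ≈⟨ eigen x ⟨
        - Δ p f x                           ≈⟨ -‿cong (*-congˡ (neighbours-φδ x)) ⟩
        - (fromℕ (degree x) ⁻¹ * - sum (λ y → φ p (δ f x y)))
          ≈⟨ -‿cong (*-congˡ (-‿cong (trans (sum-cong-≋ λ y → trans
               (φ-cong p (reflexive (δ-nonEdge f λ e → isolated (y , e)))) (φ-zero p))
               (sum-replicate-zero order)))) ⟩
        - (fromℕ (degree x) ⁻¹ * - 0#)      ≈⟨ solve 1 (λ d → :- (d :* (:- :0)) := :0) refl _ ⟩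
        0#                                  ∎

    module _ (connected : Connected) (f≉0 : ¬ (∀ x → f x ≈ 0#)) where

      -- In a connected graph an isolated vertex is the only one, and `f` vanishes there. So every
      -- degree is at least 1 and can be cleared from the equation.
      has-neighbour : ∀ x → ∃ λ y → x ~ y
      has-neighbour x with Fin.any? (x ~?_)
      ... | yes found    = found
      ... | no  isolated = contradiction f≈0 f≉0
        where
        reachable : ∀ {y} → Star _~_ x y → f y ≈ 0#
        reachable ε       = isolated⇒zero isolated
        reachable (e ◅ _) = contradiction (_ , e) isolated
        f≈0 : ∀ y → f y ≈ 0#
        f≈0 y = reachable (connected x y)

      deg : V → Carrier
      deg x = fromℕ (degree x)

      1≤deg : ∀ x → 1# ≤ deg x
      1≤deg x = 1≤degree (proj₂ (has-neighbour x))

      eigen-summed : ∀ x → sum (λ y → φ p (δ f x y)) ≈ μ * (deg x * φ p (f x))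
      eigen-summed x = sym (begin
        μ * (deg x * φ p (f x))                  ≈⟨ solve 3 (λ μ d t → μ :* (d :* t) := d :* (μ :* t)) refl μ (deg x) (φ p (f x)) ⟩
        deg x * (μ * φ p (f x))                  ≈⟨ *-congˡ (eigen x) ⟨
        deg x * - Δ p f x                        ≈⟨ *-congˡ (-‿cong (*-congˡ (neighbours-φδ x))) ⟩
        deg x * - (deg x ⁻¹ * - s)               ≈⟨ solve 3 (λ d e s → d :* (:- (e :* (:- s))) := d :* e :* s)
                                                      refl (deg x) (deg x ⁻¹) s ⟩
        deg x * deg x ⁻¹ * s                     ≈⟨ *-congʳ (⁻¹-inverseʳ (0<⇒≉0 (1≤⇒0< (1≤deg x)))) ⟩
        1# * s                                   ≈⟨ *-identityˡ s ⟩
        s                                        ∎)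
        where open ≈-R
              s = sum (λ y → φ p (δ f x y))

      norm : Carrier
      norm = sum λ x → deg x * ∣ f x ∣ ^ℝ p

      energy : Carrier
      energy = ∬ λ x y → ∣δ∣ f x y ^ℝ p

      -- Discrete integration by parts: reversing an edge turns φ(δ) into -σ φ(δ), so f x φ(δ xy) +
      -- f y φ(δ yx) = φ(δ xy) δ xy, which is ∣δ xy∣^p. Each half of the symmetrised sum is μ times
      -- `norm`.
      energy-identity : energy ≈ μ * norm + μ * norm
      energy-identity = begin
        energy                                                      ≈⟨ ∬-cong edge ⟨
        ∬ (λ x y → f x * φ p (δ f x y) + f y * φ p (δ f y x))       ≈⟨ ∬-symmetrise T ⟩
        ∬ T + ∬ T                                                   ≈⟨ +-cong half half ⟩
        μ * norm + μ * norm                                         ∎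
        where
        open ≈-R
        T : Matrix order
        T x y = f x * φ p (δ f x y)
        edge : ∀ x y → T x y + T y x ≈ ∣δ∣ f x y ^ℝ p
        edge x y = case x ~? y of λ where
            (no ¬e) → trans (+-cong
                (trans (*-congˡ (trans (φ-cong p (reflexive (δ-nonEdge f ¬e))) (φ-zero p))) (zeroʳ _))
                (trans (*-congˡ (trans (φ-cong p (reflexive (δ-nonEdge f (¬e ∘ ~-sym)))) (φ-zero p))) (zeroʳ _)))
              (trans (+-identityʳ _) (sym (∣0∣^ℝ p (reflexive (δ-nonEdge f ¬e)))))
            (yes e) → begin
              f x * φ p (δ f x y) + f y * φ p (δ f y x)
                ≈⟨ +-congˡ (*-congˡ (φ-reverse f p e)) ⟩
              f x * φ p (δ f x y) + f y * - (σ e ◃ φ p (δ f x y))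
                ≈⟨ factor (σ e) (f x) (f y) _ ⟩
              φ p (δ f x y) * (f x - (σ e ◃ f y))    ≡⟨ ≡.cong (φ p (δ f x y) *_) (δ-edge f e) ⟨
              φ p (δ f x y) * δ f x y                ≈⟨ φ-* p (δ f x y) ⟩
              ∣ δ f x y ∣ ^ℝ p                       ∎
          where
          factor : ∀ s a b t → a * t + b * - (s ◃ t) ≈ t * (a - (s ◃ b))
          factor Sign.+ a b t = solve 3 (λ a b t → a :* t :+ b :* (:- t) := t :* (a :- b)) refl a b t
          factor Sign.- a b t = solve 3 (λ a b t → a :* t :+ b :* (:- (:- t)) := t :* (a :- (:- b))) refl a b t
        half : ∬ T ≈ μ * norm
        half = begin
          ∬ T                                          ≈⟨ sum-cong-≋ (λ x → *-distribˡ-sum (f x) (λ y → φ p (δ f x y))) ⟨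
          sum (λ x → f x * sum (λ y → φ p (δ f x y)))  ≈⟨ sum-cong-≋ (λ x → trans (*-congˡ (eigen-summed x))
            (trans (solve 4 (λ a μ d t → a :* (μ :* (d :* t)) := μ :* (d :* (t :* a))) refl (f x) μ (deg x) (φ p (f x)))
              (*-congˡ (*-congˡ (φ-* p (f x)))))) ⟩
          sum (λ x → μ * (deg x * ∣ f x ∣ ^ℝ p))       ≈⟨ *-distribˡ-sum μ (λ x → deg x * ∣ f x ∣ ^ℝ p) ⟨
          μ * norm                                     ∎

      -- If every edge were consistent with the signs of f, then switching by
      -- these signs would turn the eigenvalue equation into one with zero total.
      frustrated-edge : ∃₂ (Frustrated f)
      frustrated-edge with Fin.any? (λ x → Fin.any? (frustrated? f x))
      ... | yes (x , y , e) = x , y , e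
      ... | no ¬frustrated = contradiction f≈0 f≉0
        where
        open ≈-R
        t : V → Sign
        t x = sgn (f x)
        T : Matrix order
        T x y = t x ◃ φ p (δ f x y)
        -- If the signs `r` and `r′` differ exactly as the edge sign `s` prescribes, the two terms
        -- are opposite. The other four sign patterns give a (s b) ≤ 0, the excluded case.
        cancel : ∀ s r r′ a b c → 0# ≤ r ◃ a → 0# ≤ r′ ◃ b → ¬ (a * (s ◃ b) ≤ 0#) →
          (r ◃ c) + (r′ ◃ - (s ◃ c)) ≈ 0#
        cancel Sign.+ Sign.+ Sign.+ a b c 0≤a 0≤b ¬p = solve 1 (λ c → c :+ :- c := :0) refl c
        cancel Sign.+ Sign.- Sign.- a b c 0≤a 0≤b ¬p = solve 1 (λ c → :- c :+ :- (:- c) := :0) refl c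
        cancel Sign.- Sign.+ Sign.- a b c 0≤a 0≤b ¬p = solve 1 (λ c → c :+ :- (:- (:- c)) := :0) refl c
        cancel Sign.- Sign.- Sign.+ a b c 0≤a 0≤b ¬p = solve 1 (λ c → :- c :+ :- (:- c) := :0) refl c
        cancel Sign.+ Sign.+ Sign.- a b c 0≤a 0≤b ¬p = contradiction
          (≤-respˡ-≈ (solve 2 (λ a b → :- (a :* (:- b)) := a :* b) refl a b) (0≤⇒-≤0 (*-nonNegative 0≤a 0≤b))) ¬p
        cancel Sign.+ Sign.- Sign.+ a b c 0≤a 0≤b ¬p = contradiction
          (≤-respˡ-≈ (solve 2 (λ a b → :- ((:- a) :* b) := a :* b) refl a b) (0≤⇒-≤0 (*-nonNegative 0≤a 0≤b))) ¬p
        cancel Sign.- Sign.+ Sign.+ a b c 0≤a 0≤b ¬p = contradiction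
          (≤-respˡ-≈ (solve 2 (λ a b → :- (a :* b) := a :* (:- b)) refl a b) (0≤⇒-≤0 (*-nonNegative 0≤a 0≤b))) ¬p
        cancel Sign.- Sign.- Sign.- a b c 0≤a 0≤b ¬p = contradiction
          (≤-respˡ-≈ (solve 2 (λ a b → :- ((:- a) :* (:- b)) := a :* (:- b)) refl a b) (0≤⇒-≤0 (*-nonNegative 0≤a 0≤b))) ¬p
        ◃-zero : ∀ s → s ◃ 0# ≈ 0#
        ◃-zero Sign.+ = refl
        ◃-zero Sign.- = -0#≈0#
        vanish : ∀ {x y} → ¬ x ~ y → T x y ≈ 0#
        vanish {x} {y} ¬e = trans (◃-cong (t x) (trans (φ-cong p (reflexive (δ-nonEdge f ¬e))) (φ-zero p))) (◃-zero (t x))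
        antisymmetric : ∀ x y → T x y + T y x ≈ 0#
        antisymmetric x y = case x ~? y of λ where
          (no ¬e) → trans (+-cong (vanish ¬e) (vanish (¬e ∘ ~-sym))) (+-identityʳ _)
          (yes e) → trans (+-congˡ (◃-cong (t y) (φ-reverse f p e)))
            (cancel (σ e) (t x) (t y) (f x) (f y) _ (sgn-◃-nonNeg (f x)) (sgn-◃-nonNeg (f y))
              λ q → ¬frustrated (x , y , e , q))
        ∬T≈0 : ∬ T ≈ 0#
        ∬T≈0 = x+x≈0⇒x≈0 (trans (sym (∬-symmetrise T)) (∬-zero antisymmetric))
        ◃-sum : ∀ {n} s (u : Fin n → Carrier) → sum (λ y → s ◃ u y) ≈ s ◃ sum u
        ◃-sum Sign.+ u = refl
        ◃-sum Sign.- u = trans (sum-cong-≋ (λ i → solve 1 (λ a → :- a := :- :1 :* a) refl (u i)))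
          (trans (sym (*-distribˡ-sum (- 1#) u)) (solve 1 (λ a → :- :1 :* a := :- a) refl (sum u)))
        -- `t x ◃ f x` is nonnegative, and positive where `f x` is nonzero; so every `R x` is
        -- nonnegative, and a zero total leaves no vertex with nonzero value.
        R : V → Carrier
        R x = deg x * (∣ f x ∣ ^ℝ (p - 2#) * (t x ◃ f x))
        ∬T≈ : ∬ T ≈ μ * sum R
        ∬T≈ = begin
          ∬ T                                            ≈⟨ sum-cong-≋ (λ x → ◃-sum (t x) (λ y → φ p (δ f x y))) ⟩
          sum (λ x → t x ◃ sum (λ y → φ p (δ f x y)))    ≈⟨ sum-cong-≋ (λ x → trans (◃-cong (t x) (eigen-summed x))
            (trans (sym (*-◃ (t x) μ _)) (*-congˡ (trans (sym (*-◃ (t x) (deg x) _)) (*-congˡ (sym (*-◃ (t x) _ (f x)))))))) ⟩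
          sum (λ x → μ * R x)                            ≈⟨ *-distribˡ-sum μ R ⟨
          μ * sum R                                      ∎
        sumR≈0 : sum R ≈ 0#
        sumR≈0 = *-cancelˡ μ≉0 (trans (sym ∬T≈) (trans ∬T≈0 (sym (zeroʳ μ))))
        0≤R : ∀ x → 0# ≤ R x
        0≤R x = *-nonNegative (fromℕ-nonNeg (degree x)) (*-nonNegative (^ℝ-nonNeg _ _) (sgn-◃-nonNeg (f x)))
        f≈0 : ∀ x → f x ≈ 0#
        f≈0 x = case f x ≈? 0# of λ where
          (yes fx≈0) → fx≈0
          (no  fx≉0) → contradiction
            (≤-respʳ-≈ sumR≈0 (term≤sum 0≤R x))
            (<⇒≱ (*-positive (1≤⇒0< (1≤deg x))
              (*-positive (^ℝ-positive _ (x≉0⇒0<∣x∣ fx≉0)) (sgn-◃-positive fx≉0))))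

      sup-attained : ∃ λ m → (∀ x → ∣ f x ∣ ≤ ∣ f m ∣) × 0# < ∣ f m ∣
      -- `maximum` needs an inhabited index set; the frustrated edge supplies a vertex.
      sup-attained with maximum (∣_∣ ∘ f) (proj₁ frustrated-edge)
      ... | m , ≤m = m , ≤m , ≰⇒> λ M≤0 → f≉0 λ x → case f x ≈? 0# of λ where
        (yes fx≈0) → fx≈0
        (no  fx≉0) → contradiction (≤-trans (≤m x) M≤0) (<⇒≱ (x≉0⇒0<∣x∣ fx≉0))

      -- The lower bound for the energy and for the eigenvalue.

      module _ (1<p : 1# < p) (m : V) (≤M : ∀ x → ∣ f x ∣ ≤ ∣ f m ∣) (0<M : 0# < ∣ f m ∣) where

        M K κ c Ec : Carrier
        M  = ∣ f m ∣
        K  = fromℕ vol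
        κ  = 2# * (p * K) ⁻¹
        c  = M * κ
        Ec = c ^ℝ p

        0<p : 0# < p
        0<p = 1≤⇒0< (<⇒≤ 1<p)

        0<K : 0# < K
        0<K = <-≤-trans (1≤⇒0< (1≤deg m)) (≤-respʳ-≈ (sym (fromℕ-sum degree))
          (term≤sum (λ x → fromℕ-nonNeg (degree x)) m))

        0<pK = *-positive 0<p 0<K

        0<κ : 0# < κ
        0<κ = *-positive (+-positiveˡ 0<1 0≤1) (⁻¹-positive 0<pK)

        0<c : 0# < c
        0<c = *-positive 0<M 0<κ

        0<Ec = ^ℝ-positive p 0<c

        norm-upper : norm ≤ K * M ^ℝ p
        norm-upper = begin
          norm                           ≤⟨ sum-mono (λ x → *-monoˡ-≤ (fromℕ-nonNeg (degree x)) (^ℝ-mono (<⇒≤ 0<p) (≤M x))) ⟩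
          sum (λ x → deg x * M ^ℝ p)     ≈⟨ *-distribʳ-sum (M ^ℝ p) deg ⟨
          sum deg * M ^ℝ p               ≈⟨ *-congʳ (fromℕ-sum degree) ⟨
          K * M ^ℝ p                     ∎
          where open ≤-R

        0<norm : 0# < norm
        0<norm = <-≤-trans (*-positive (1≤⇒0< (1≤deg m)) (^ℝ-positive p 0<M))
          (term≤sum (λ x → *-nonNegative (fromℕ-nonNeg (degree x)) (^ℝ-nonNeg _ p)) m)

        -- Twice μ times the positive `norm` is the energy, a sum of nonnegative powers. The sign is
        -- needed to multiply `norm-upper` by μ.
        0≤μ : 0# ≤ μ
        0≤μ = *-cancelˡ-≤ (+-positiveˡ 0<norm (<⇒≤ 0<norm)) (begin
          (norm + norm) * 0#      ≈⟨ zeroʳ _ ⟩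
          0#                      ≤⟨ ∬-nonNeg {w = λ x y → ∣δ∣ f x y ^ℝ p} (λ x y → ^ℝ-nonNeg _ p) ⟩
          energy                  ≈⟨ energy-identity ⟩
          μ * norm + μ * norm     ≈⟨ solve 2 (λ μ n → μ :* n :+ μ :* n := (n :+ n) :* μ) refl μ norm ⟩
          (norm + norm) * μ       ∎)
          where open ≤-R

        scaled-bernoulli : ∀ x → 0# ≤ x → Ec * (x * c ⁻¹ - (p - 1#)) ≤ x ^ℝ p
        scaled-bernoulli x 0≤x = begin
          Ec * (x * c ⁻¹ - (p - 1#))  ≤⟨ *-monoˡ-≤ (<⇒≤ 0<Ec) (^ℝ-bernoulli
                                           (*-nonNegative 0≤x (<⇒≤ (⁻¹-positive 0<c))) 1<p) ⟩
          Ec * (x * c ⁻¹) ^ℝ p        ≈⟨ rescale ⟩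
          x ^ℝ p                      ∎
          where
          open ≤-R
          rescale : Ec * (x * c ⁻¹) ^ℝ p ≈ x ^ℝ p
          -- Multiplicativity of `^ℝ` is available for positive bases, so the value 0 is treated by
          -- its convention.
          rescale = case x ≈? 0# of λ where
            (yes x≈0) → trans (*-congˡ (reflexive (^ℝ-≤0 p (≤-reflexive (trans (*-congʳ x≈0) (zeroˡ _))))))
              (trans (zeroʳ _) (sym (reflexive (^ℝ-≤0 p (≤-reflexive x≈0)))))
            (no x≉0) → trans (sym (^ℝ-* p 0<c (*-positive (0≤x , x≉0 ∘ sym) (⁻¹-positive 0<c))))
              (^ℝ-cong (*-⁻¹-cancel x (0<⇒≉0 0<c)) refl)

        -- The factor `adjacency` confines the constant p - 1 to edges, so that summation produces
        -- (p - 1) vol rather than a multiple of the number of all pairs.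
        energy-lower-pointwise : ∀ x y →
          Ec * c ⁻¹ * ∣δ∣ f x y ≤ ∣δ∣ f x y ^ℝ p + Ec * (p - 1#) * adjacency x y
        energy-lower-pointwise x y with x ~? y
        ... | no _ = ≤-reflexive (begin
          Ec * c ⁻¹ * ∣ 0# ∣               ≈⟨ trans (*-congˡ (reflexive (∣∣-nonNeg ≤-refl))) (zeroʳ _) ⟩
          0#                               ≈⟨ +-identityʳ 0# ⟨
          0# + 0#                          ≈⟨ +-cong (∣0∣^ℝ p refl) (zeroʳ _) ⟨
          ∣ 0# ∣ ^ℝ p + Ec * (p - 1#) * 0# ∎)
          where open ≈-R
        ... | yes e = begin
          Ec * c ⁻¹ * d                              ≈⟨ solve 4 (λ E c d a → E :* c :* d := E :* (d :* c :- a) :+ E :* a :* :1)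
                                                          refl Ec (c ⁻¹) d (p - 1#) ⟩
          Ec * (d * c ⁻¹ - (p - 1#)) + Ec * (p - 1#) * 1#  ≤⟨ +-mono-≤ (scaled-bernoulli d (0≤∣∣ _)) ≤-refl ⟩
          d ^ℝ p + Ec * (p - 1#) * 1#                ∎
          where open ≤-R
                d = ∣ f x - (σ e ◃ f y) ∣

        -- This equation is what fixes the scale `c`: in the summed tangent bound the linear part
        -- contributes p K, the constant part takes away (p - 1) K, and K times c^p remains.
        c⁻¹*2M : c ⁻¹ * (M + M) ≈ p * K
        c⁻¹*2M = *-cancelˡ (0<⇒≉0 0<c) (begin
          c * (c ⁻¹ * (M + M))               ≈⟨ *-assoc _ _ _ ⟨
          c * c ⁻¹ * (M + M)                 ≈⟨ *-congʳ (⁻¹-inverseʳ (0<⇒≉0 0<c)) ⟩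
          1# * (M + M)                       ≈⟨ solve 1 (λ M → :1 :* (M :+ M) := M :* ((:1 :+ :1) :* :1)) refl M ⟩
          M * (2# * 1#)                      ≈⟨ *-congˡ (*-congˡ (⁻¹-inverseʳ (0<⇒≉0 0<pK))) ⟨
          M * (2# * (p * K * (p * K) ⁻¹))    ≈⟨ solve 4 (λ M t q r → M :* (t :* (q :* r)) := M :* (t :* r) :* q)
                                                  refl M 2# (p * K) ((p * K) ⁻¹) ⟩
          c * (p * K)                        ∎)
          where open ≈-R

        energy-lower : K * Ec ≤ energy
        energy-lower = 0≤y-x⇒x≤y (≤-respʳ-≈
          (solve 4 (λ e E p K → e :+ E :* (p :- :1) :* K :- E :* (p :* K) := e :- K :* E) refl energy Ec p K)
          (x≤y⇒0≤y-x (begin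
            Ec * (p * K)                           ≈⟨ *-congˡ c⁻¹*2M ⟨
            Ec * (c ⁻¹ * (M + M))                  ≈⟨ *-assoc _ _ _ ⟨
            Ec * c ⁻¹ * (M + M)                    ≤⟨ *-monoˡ-≤ (<⇒≤ (*-positive 0<Ec (⁻¹-positive 0<c)))
                                                        (frustrated⇒total-variation f connected (proj₂ (proj₂ frustrated-edge)) m) ⟩
            Ec * c ⁻¹ * ∬ (∣δ∣ f)                  ≈⟨ ∬-* (Ec * c ⁻¹) (∣δ∣ f) ⟨
            ∬ (λ x y → Ec * c ⁻¹ * ∣δ∣ f x y)      ≤⟨ ∬-mono energy-lower-pointwise ⟩
            ∬ (λ x y → ∣δ∣ f x y ^ℝ p + Ec * (p - 1#) * adjacency x y)
              ≈⟨ ∬-+ (λ x y → ∣δ∣ f x y ^ℝ p) (λ x y → Ec * (p - 1#) * adjacency x y) ⟩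
            energy + ∬ (λ x y → Ec * (p - 1#) * adjacency x y)
              ≈⟨ +-congˡ (trans (∬-* (Ec * (p - 1#)) adjacency) (*-congˡ (sym vol-sum))) ⟩
            energy + Ec * (p - 1#) * K             ∎)))
          where open ≤-R

        -- Since c = M κ, the lower estimate of the energy is K M^p κ^p, while the upper one is 2 μ
        -- K M^p. The common factor K M^p cancels, which removes the dependence on `f`.
        frustrated-bound : 2# ⁻¹ * κ ^ℝ p ≤ μ
        frustrated-bound = *-cancelˡ-≤ (*-positive 0<2 (*-positive 0<K 0<EM)) (begin
          2# * (K * EM) * (2# ⁻¹ * κ ^ℝ p)   ≈⟨ solve 5 (λ t u K M k → t :* (K :* M) :* (u :* k) := t :* u :* (K :* (M :* k)))
                                                  refl 2# (2# ⁻¹) K EM (κ ^ℝ p) ⟩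
          2# * 2# ⁻¹ * (K * (EM * κ ^ℝ p))   ≈⟨ *-congʳ (⁻¹-inverseʳ (0<⇒≉0 0<2)) ⟩
          1# * (K * (EM * κ ^ℝ p))           ≈⟨ *-identityˡ _ ⟩
          K * (EM * κ ^ℝ p)                  ≈⟨ *-congˡ (^ℝ-* p 0<M 0<κ) ⟨
          K * Ec                             ≤⟨ energy-lower ⟩
          energy                             ≈⟨ energy-identity ⟩
          μ * norm + μ * norm                ≤⟨ +-mono-≤ (*-monoˡ-≤ 0≤μ norm-upper) (*-monoˡ-≤ 0≤μ norm-upper) ⟩
          μ * (K * EM) + μ * (K * EM)        ≈⟨ solve 2 (λ μ n → μ :* n :+ μ :* n := (:1 :+ :1) :* n :* μ) refl μ (K * EM) ⟩
          2# * (K * EM) * μ                  ∎)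
          where
          open ≤-R
          EM = M ^ℝ p
          0<EM = ^ℝ-positive p 0<M
          0<2 : 0# < 2#
          0<2 = +-positiveˡ 0<1 0≤1

  eigenvalue-bound : Connected → ∀ {p μ} → 1# < p → IsEigenvalue p μ → μ ≉ 0# →
    2# ⁻¹ * (2# * (p * fromℕ vol) ⁻¹) ^ℝ p ≤ μ
  eigenvalue-bound connected 1<p (f , f≉0 , eigen) μ≉0
    with sup-attained eigen μ≉0 connected f≉0
  ... | m , ≤M , 0<M = frustrated-bound eigen μ≉0 connected f≉0 1<p m ≤M 0<M

theorem4p3 :
  (ℝ : CompleteOrderedField) (G : SimpleGraph) (S : Signature G) →
  SimpleGraph.Connected G →
  let open CompleteOrderedField ℝ
      open SimpleGraph G using (vol)
      open SignedPLaplacian ℝ G S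
  in ∀ (p : Carrier) → 1# < p →
     ∀ (lam : Carrier) → IsFirstNonzeroEigenvalue p lam →
     2# ⁻¹ * (2# * (p * fromℕ vol) ⁻¹) ^ℝ p ≤ lam
theorem4p3 ℝ G S connected p 1<p lam ((eigenvalue , lam≉0) , _) =
  Eigenfunctions.eigenvalue-bound ℝ G S connected 1<p eigenvalue lam≉0
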